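{- Let $m,n$ be integers with $m,n\ge 5$ and $|n-m|\ge 2$. Then $$f\big(M(C_{2n})\times M(C_{2m})\big)\le f\big(M(C_{2n})\big)\,f\big(M(C_{2m})\big).$$
   Context: A distribution of pebbles on a graph assigns a nonnegative integer number of pebbles to each vertex. A pebbling move removes two pebbles from a vertex and places one pebble on an adjacent vertex. For a connected graph $G$ and a vertex $v$, $f(G,v)$ is the smallest integer $N$ such that from every distribution of $N$ pebbles on $G$ one pebble can be moved to $v$ by a sequence of pebbling moves; the pebbling number is $f(G)=\max_{v\in V(G)} f(G,v)$. $C_k$ denotes the cycle on $k$ vertices. The middle graph $M(G)$ of a graph $G$ is obtained from $G$ by inserting a new vertex into each edge of $G$ (subdividing it), and joining two new vertices by an edge whenever the two edges of $G$ they were inserted into share a common endpoint. For graphs $G_1,G_2$, the Cartesian product $G_1\times G_2$ has vertex set $V(G_1)\times V(G_2)$, with $(u_1,v_1)$ adjacent to $(u_2,v_2)$ iff either $u_1=u_2$ and $v_1v_2\in E(G_2)$, or $u_1u_2\in E(G_1)$ and $v_1=v_2$. -}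

module Defs where

open import Data.Nat as ℕ using (ℕ; zero; suc; _+_; _*_; _∸_; _≤_; _<?_)
open import Data.Fin as Fin using (Fin; toℕ; fromℕ<; splitAt; remQuot)
open import Data.Fin.Properties using (_≟_)
open import Data.List using (List; map; allFin; length; lookup)
open import Data.Nat.ListAction using (sum)
open import Data.Empty using (⊥)
open import Data.Product using (Σ; _×_; _,_; ∃-syntax)
open import Data.Sum using (_⊎_; inj₁; inj₂)
open import Relation.Binary.PropositionalEquality using (_≡_; _≢_)
open import Relation.Nullary using (does; yes; no)
open import Data.Bool using (if_then_else_)
open import Relation.Binary.Construct.Closure.ReflexiveTransitive using (Star)
open import Level using (0ℓ)

record Graph : Set₁ where
  field
    size : ℕ
    Adj  : Fin size → Fin size → Set
open Graph public

-- Edge lists: an edge is an (unordered) pair given as an ordered pair.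
EdgeList : ℕ → Set
EdgeList n = List (Fin n × Fin n)

Endpoint : ∀ {n} → Fin n → Fin n × Fin n → Set
Endpoint u (a , b) = (u ≡ a) ⊎ (u ≡ b)

ShareEndpoint : ∀ {n} → Fin n × Fin n → Fin n × Fin n → Set
ShareEndpoint (a , b) e = Endpoint a e ⊎ Endpoint b e

cycNext : ∀ {k} → Fin k → Fin k
cycNext {suc k} i with suc (toℕ i) <? suc k
... | yes p = fromℕ< p
... | no _  = Fin.zero

cycleEdges : (k : ℕ) → EdgeList k
cycleEdges k = map (λ i → (i , cycNext i)) (allFin k)

fromEdges : (n : ℕ) → EdgeList n → Graph
fromEdges n E = record
  { size = n
  ; Adj  = λ u v → ∃[ e ] (lookup E e ≡ (u , v) ⊎ lookup E e ≡ (v , u)) }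

C : ℕ → Graph
C k = fromEdges k (cycleEdges k)

-- middle graph M(G) of the graph with n vertices and edge list E:
-- vertices are the original vertices (first n) followed by one new vertex per edge.
-- Original vertex u ~ edge-vertex e iff u is an endpoint of e (subdivision);
-- edge-vertices e ~ e' iff e ≢ e' and the edges share an endpoint.
MAdj : ∀ {n} (E : EdgeList n) → Fin n ⊎ Fin (length E) → Fin n ⊎ Fin (length E) → Set
MAdj E (inj₁ u) (inj₁ v) = ⊥
MAdj E (inj₁ u) (inj₂ e) = Endpoint u (lookup E e)
MAdj E (inj₂ e) (inj₁ u) = Endpoint u (lookup E e)
MAdj E (inj₂ e) (inj₂ e') = (e ≢ e') × ShareEndpoint (lookup E e) (lookup E e')

M : (n : ℕ) → EdgeList n → Graph
M n E = record
  { size = n + length E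
  ; Adj  = λ x y → MAdj E (splitAt n x) (splitAt n y) }

MC : ℕ → Graph
MC k = M k (cycleEdges k)

-- Cartesian product; vertex (a , b) is encoded as Fin.combine a b
_□_ : Graph → Graph → Graph
G □ H = record
  { size = size G * size H
  ; Adj  = λ x y → Rel (remQuot (size H) x) (remQuot (size H) y) }
  where
  Rel : Fin (size G) × Fin (size H) → Fin (size G) × Fin (size H) → Set
  Rel (a , b) (c , d) = (a ≡ c × Adj H b d) ⊎ (Adj G a c × b ≡ d)

Distribution : Graph → Set
Distribution G = Fin (size G) → ℕ

total : (G : Graph) → Distribution G → ℕ
total G D = sum (map D (allFin (size G)))

move : (G : Graph) → Fin (size G) → Fin (size G) → Distribution G → Distribution G
move G u w D x =
  (D x ∸ (if does (x ≟ u) then 2 else 0)) + (if does (x ≟ w) then 1 else 0)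

data Step (G : Graph) : Distribution G → Distribution G → Set where
  step : ∀ {D} u w → Adj G u w → 2 ≤ D u → Step G D (move G u w D)

Reach : (G : Graph) → Distribution G → Distribution G → Set
Reach G = Star (Step G)

Solvable : (G : Graph) → Fin (size G) → ℕ → Set
Solvable G v N = ∀ (D : Distribution G) → total G D ≡ N →
  ∃[ D' ] (Reach G D D' × 1 ≤ D' v)

IsPebblingNumberAt : (G : Graph) → Fin (size G) → ℕ → Set
IsPebblingNumberAt G v N = Solvable G v N × (∀ K → Solvable G v K → N ≤ K)

IsPebblingNumber : Graph → ℕ → Set
IsPebblingNumber G N =
  (∃[ v ] IsPebblingNumberAt G v N) × (∀ v K → IsPebblingNumberAt G v K → K ≤ N)

module Submission where

-- Each copy of M(C_2s) in the product, s being the smaller index, is a fibre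
-- over a vertex of M(C_2l).  A distribution of at least t 2^(s+1) + 2s pebbles on
-- a fibre puts t pebbles on any chosen vertex of it: after discarding one pebble
-- from each original vertex holding an odd number, all remaining pebbles can move
-- along one of the two arcs leading to the target, and the better arc suffices.
-- Collecting in every fibre leaves a distribution on a copy of M(C_2l), which the
-- same fact solves, because l ≥ s + 2 makes the surplus of f(M(C_2s)) f(M(C_2l))
-- over 2^(s+l+2) exceed what is wasted in the 4l fibres.
-- The bound f(M(C_2k)) ≥ 2^(k+1) + 2k - 2 comes from the distribution with
-- 2^(k+1) - 1 pebbles on an original vertex and one on every other original vertex
-- except the antipode, the target.

open import Defs
open import Data.Bool using (if_then_else_)
open import Data.Fin as Fin using (Fin; toℕ; splitAt; _↑ˡ_; _↑ʳ_; cast; combine; remQuot)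
open import Data.Fin.Properties using (_≟_; toℕ-fromℕ<; toℕ-injective; toℕ<n; toℕ≤pred[n]; splitAt-↑ˡ; splitAt-↑ʳ; join-splitAt; cast-is-id; cast-involutive; remQuot-combine; combine-remQuot)
import Data.List as List hiding (sum)
open import Data.List.Properties using (map-tabulate; length-map; length-tabulate)
open import Data.Nat using (ℕ; zero; suc; pred; _+_; _*_; _∸_; _^_; _/_; _%_; _⊓_; _≤_; _<_; z≤n; s≤s; s≤s⁻¹; ⌊_/2⌋; ⌈_/2⌉; _≤?_; _<?_)
open import Data.Nat.DivMod using (m%n<n; m≡m%n+[m/n]*n)
open import Data.Nat.Induction using (<-rec)
import Data.Nat.ListAction as List using (sum)
open import Data.Nat.Properties hiding (_≟_)
open import Data.Nat.Tactic.RingSolver using (solve-∀)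
open import Data.Product using (_×_; _,_; ∃-syntax; proj₁; proj₂)
open import Data.Sum using (_⊎_; inj₁; inj₂; [_,_]′)
open import Function using (_∘_; id)
open import Relation.Binary.Construct.Closure.ReflexiveTransitive using (ε; _◅_; _◅◅_)
open import Relation.Binary.PropositionalEquality
open import Relation.Nullary using (¬_; does; yes; no; contradiction)
open import Relation.Nullary.Decidable using (decidable-stable)
open import Algebra.Properties.Semiring.Sum +-*-semiring using (sum; sum-cong-≗; ∑-distrib-+; ∑-comm; *-distribʳ-sum; sum-replicate-zero)

-- Sums and pebbling moves

sum-mono : ∀ {n} {f g : Fin n → ℕ} → (∀ i → f i ≤ g i) → sum f ≤ sum g
sum-mono {zero}  f≤g = z≤n
sum-mono {suc n} f≤g = +-mono-≤ (f≤g Fin.zero) (sum-mono (f≤g ∘ Fin.suc))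

-- Written with the same test as `move`, so that the pebble a move adds at `w` is `δ w` by
-- definition.
δ : ∀ {n} → Fin n → Fin n → ℕ
δ u z = if does (z ≟ u) then 1 else 0

δ-sym : ∀ {n} (u z : Fin n) → δ u z ≡ δ z u
δ-sym Fin.zero    Fin.zero    = refl
δ-sym Fin.zero    (Fin.suc z) = refl
δ-sym (Fin.suc u) Fin.zero    = refl
δ-sym (Fin.suc u) (Fin.suc z) = δ-sym u z

sum-δ : ∀ {n} (F : Fin n → ℕ) u → sum (λ i → F i * δ u i) ≡ F u
sum-δ {suc n} F Fin.zero = begin
  F Fin.zero * 1 + sum (λ i → F (Fin.suc i) * 0)
    ≡⟨ cong₂ _+_ (*-identityʳ _) (trans (sum-cong-≗ λ i → *-zeroʳ (F (Fin.suc i))) (sum-replicate-zero n)) ⟩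
  F Fin.zero + 0  ≡⟨ +-identityʳ _ ⟩
  F Fin.zero      ∎
  where open ≡-Reasoning
sum-δ {suc n} F (Fin.suc u) = cong₂ _+_ (*-zeroʳ (F Fin.zero)) (sum-δ (F ∘ Fin.suc) u)

total≡sum : ∀ G D → total G D ≡ sum D
total≡sum G D = trans (cong List.sum (map-tabulate id D)) (sum-tabulate D)
  where
  sum-tabulate : ∀ {n} (f : Fin n → ℕ) → List.sum (List.tabulate f) ≡ sum f
  sum-tabulate {zero}  f = refl
  sum-tabulate {suc n} f = cong (f Fin.zero +_) (sum-tabulate (f ∘ Fin.suc))

infixl 6 _⊕_
_⊕_ : ∀ {n} → (Fin n → ℕ) → (Fin n → ℕ) → (Fin n → ℕ)
(D ⊕ E) z = D z + E z

infix 7 _•_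
_•_ : ∀ {n} → ℕ → Fin n → (Fin n → ℕ)
(c • u) z = c * δ u z

infix 4 _⊢_⇝_
-- Domination replaces equality: surplus pebbles may be forgotten, and distributions, being
-- functions, never have to be proved equal.
_⊢_⇝_ : (X : Graph) → Distribution X → Distribution X → Set
X ⊢ D ⇝ E = ∃[ D' ] (Reach X D D' × (∀ z → E z ≤ D' z))

-- The same moves stay legal when more pebbles are present. That `H` dominates the sum of `D` and
-- `F` is an invariant of each move; truncated subtraction does no harm because a move requires
-- `2 ≤ D u`.
Reach-frame : ∀ {X} {D D' : Distribution X} (F : Distribution X) {H} → Reach X D D' →
  (∀ z → D z + F z ≤ H z) → X ⊢ H ⇝ D' ⊕ F
Reach-frame F ε D+F≤H = _ , ε , D+F≤H
Reach-frame {X} F {H} (step {D} u w u~w 2≤Du ◅ r) D+F≤H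
  with Reach-frame {X} F {move X u w H} r moved
  where
  shift : ∀ {d f h} a b → a ≤ d → d + f ≤ h → d ∸ a + b + f ≤ h ∸ a + b
  shift {d} {f} {h} a b a≤d d+f≤h = begin
    d ∸ a + b + f    ≡⟨ rotate₃ (d ∸ a) b f ⟩
    f + (d ∸ a) + b  ≡⟨ cong (_+ b) (sym (+-∸-assoc f a≤d)) ⟩
    f + d ∸ a + b    ≤⟨ +-monoˡ-≤ b (∸-monoˡ-≤ a (subst (_≤ h) (+-comm d f) d+f≤h)) ⟩
    h ∸ a + b        ∎
    where
    open ≤-Reasoning
    rotate₃ : ∀ x y z → x + y + z ≡ z + x + y
    rotate₃ = solve-∀
  removable : ∀ z → (if does (z ≟ u) then 2 else 0) ≤ D z
  removable z with z ≟ u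
  ... | yes refl = 2≤Du
  ... | no _     = z≤n
  moved : ∀ z → move X u w D z + F z ≤ move X u w H z
  moved z = shift _ _ (removable z) (D+F≤H z)
... | H' , r' , le = H' , step u w u~w (≤-trans 2≤Du (m+n≤o⇒m≤o (D u) (D+F≤H u))) ◅ r' , le

module _ {X : Graph} where

  ⇝-≥ : {D E : Distribution X} → (∀ z → E z ≤ D z) → X ⊢ D ⇝ E
  ⇝-≥ E≤D = _ , ε , E≤D

  ⇝-trans : {D E F : Distribution X} → X ⊢ D ⇝ E → X ⊢ E ⇝ F → X ⊢ D ⇝ F
  ⇝-trans {D} {E} (D' , r , E≤D') (E' , s , F≤E')
    with Reach-frame {X} (λ _ → 0) {D'} s (λ z → ≤-trans (≤-reflexive (+-identityʳ _)) (E≤D' z))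
  ... | D″ , r' , E'≤D″ = D″ , r ◅◅ r' ,
        λ z → ≤-trans (F≤E' z) (≤-trans (≤-reflexive (sym (+-identityʳ _))) (E'≤D″ z))

  ⇝-resp-≤ : {D D₀ E E₀ : Distribution X} → (∀ z → D₀ z ≤ D z) → (∀ z → E₀ z ≤ E z) →
    X ⊢ D₀ ⇝ E → X ⊢ D ⇝ E₀
  ⇝-resp-≤ D₀≤D E₀≤E r = ⇝-trans (⇝-≥ D₀≤D) (⇝-trans r (⇝-≥ E₀≤E))

  ⇝-frame : {D E : Distribution X} (F : Distribution X) → X ⊢ D ⇝ E → X ⊢ D ⊕ F ⇝ E ⊕ F
  ⇝-frame F (D' , r , E≤D') =
    ⇝-trans (Reach-frame F r (λ z → ≤-refl)) (⇝-≥ λ z → +-monoˡ-≤ (F z) (E≤D' z))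

  ⇝-⊕ : {D₁ D₂ E₁ E₂ : Distribution X} → X ⊢ D₁ ⇝ E₁ → X ⊢ D₂ ⇝ E₂ → X ⊢ D₁ ⊕ D₂ ⇝ E₁ ⊕ E₂
  ⇝-⊕ {D₁} {D₂} {E₁} {E₂} r₁ r₂ = ⇝-trans (⇝-frame D₂ r₁)
    (⇝-resp-≤ (λ z → ≤-reflexive (+-comm (D₂ z) (E₁ z)))
              (λ z → ≤-reflexive (+-comm (E₁ z) (E₂ z)))
              (⇝-frame E₁ r₂))

  ⇝-sum : ∀ {n} (D E : Fin n → Distribution X) → (∀ i → X ⊢ D i ⇝ E i) →
    X ⊢ (λ z → sum λ i → D i z) ⇝ (λ z → sum λ i → E i z)
  ⇝-sum {zero}  D E r = ⇝-≥ λ _ → z≤n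
  ⇝-sum {suc n} D E r = ⇝-⊕ (r Fin.zero) (⇝-sum (D ∘ Fin.suc) (E ∘ Fin.suc) (r ∘ Fin.suc))

  ⇝-moves : ∀ {u w} k → Adj X u w → X ⊢ (2 * k) • u ⇝ k • w
  ⇝-moves zero u~w = ⇝-≥ λ _ → z≤n
  ⇝-moves {u} {w} (suc k) u~w = ⇝-resp-≤
    (λ z → ≤-reflexive (eq k (δ u z)))
    (λ z → ≤-refl)
    (⇝-⊕ {D₂ = (2 * k) • u} (⇝-move) (⇝-moves k u~w))
    where
    eq : ∀ k d → 2 * d + (2 * k) * d ≡ (2 * suc k) * d
    eq = solve-∀
    two : ∀ {n} (u : Fin n) → 2 ≤ 2 * δ u u
    two Fin.zero    = ≤-refl
    two (Fin.suc u) = two u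
    ⇝-move : X ⊢ 2 • u ⇝ (λ z → δ w z)
    ⇝-move = _ , step u w u~w (two u) ◅ ε , λ z → m≤n+m (δ w z) _

-- Collecting pebbles along a path with pendant vertices

pushforward : ∀ {m n} → (Fin m → Fin n) → (Fin m → ℕ) → (Fin n → ℕ)
pushforward f D z = sum λ a → D a * δ (f a) z

-- A pair of pebbles on the pendant vertex of the last layer is worth only one
-- pebble on x m, and pebbles nearer to x 0 are undervalued, so that the weight
-- of an arm is nearly its number of pebbles.
armWeight : ℕ → (q h : ℕ → ℕ) → ℕ
armWeight zero    q h = q 0 + h 0
armWeight (suc m) q h = q 0 + 2 * h 0 + armWeight m (q ∘ suc) (h ∘ suc)

-- Models a path `x 0`, ..., `x m` with a pendant vertex `y j` at each `x j`. Pendant vertices carry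
-- even amounts, the part that can be moved off in pairs.
arm : ∀ {n} (m : ℕ) (x y : ℕ → Fin n) (q h : ℕ → ℕ) → Fin n → ℕ
arm m x y q h z = sum {suc m} λ j →
  q (toℕ j) * δ (x (toℕ j)) z + (2 * h (toℕ j)) * δ (y (toℕ j)) z

-- Induction outwards from the target: the first layer delivers `c` pebbles at `x 0`, and each of
-- the missing `t ∸ c` is requested as two pebbles at `x 1`. If `c` exceeds `t`, nothing is
-- requested.
arm-⇝ : ∀ {X} m (x y : ℕ → Fin (size X)) (q h : ℕ → ℕ) t →
  (∀ j → j < m → Adj X (x (suc j)) (x j)) → (∀ j → j ≤ m → Adj X (y j) (x j)) →
  t * 2 ^ m ≤ armWeight m q h → X ⊢ arm m x y q h ⇝ t • x 0
arm-⇝ {X} zero x y q h t x~x y~x t≤ = ⇝-resp-≤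
  (λ z → ≤-reflexive (sym (+-identityʳ _)))
  (λ z → ≤-trans (*-monoˡ-≤ (δ (x 0) z) (subst (_≤ q 0 + h 0) (*-identityʳ t) t≤))
                 (≤-reflexive (*-distribʳ-+ (δ (x 0) z) (q 0) (h 0))))
  (⇝-⊕ {X} {q 0 • x 0} (⇝-≥ λ _ → ≤-refl) (⇝-moves (h 0) (y~x 0 z≤n)))
arm-⇝ {X} (suc m) x y q h t x~x y~x t≤ = ⇝-resp-≤
  (λ z → ≤-refl)
  (λ z → ≤-trans (*-monoˡ-≤ (δ (x 0) z) (m≤n+m∸n t c))
                 (≤-reflexive (dist (q 0) (h 0) (t ∸ c) (δ (x 0) z))))
  (⇝-⊕ (⇝-⊕ {X} {q 0 • x 0} (⇝-≥ λ _ → ≤-refl) (⇝-moves (h 0) (y~x 0 z≤n)))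
       (⇝-trans (arm-⇝ {X} m (x ∘ suc) (y ∘ suc) (q ∘ suc) (h ∘ suc) (2 * (t ∸ c))
                       (λ j j<m → x~x (suc j) (s≤s j<m)) (λ j j≤m → y~x (suc j) (s≤s j≤m)) rest)
                (⇝-moves (t ∸ c) (x~x 0 (s≤s z≤n)))))
  where
  open ≤-Reasoning
  c = q 0 + h 0
  dist : ∀ q h s d → (q + h + s) * d ≡ q * d + h * d + s * d
  dist = solve-∀
  -- Lowering the request by `c` lowers the requirement by `c * 2 ^ suc m`, at least what the first
  -- layer contributed to the weight.
  head≤ : q 0 + 2 * h 0 ≤ c * 2 ^ suc m
  head≤ = begin
    q 0 + 2 * h 0          ≤⟨ +-monoˡ-≤ (2 * h 0) (m≤m+n (q 0) _) ⟩
    2 * q 0 + 2 * h 0      ≡⟨ sym (*-distribˡ-+ 2 (q 0) (h 0)) ⟩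
    2 * c                  ≡⟨ *-comm 2 c ⟩
    c * 2                  ≤⟨ *-monoʳ-≤ c (*-monoʳ-≤ 2 (m^n>0 2 m)) ⟩
    c * 2 ^ suc m          ∎
  assoc2 : ∀ s p → 2 * s * p ≡ s * (2 * p)
  assoc2 = solve-∀
  rest : 2 * (t ∸ c) * 2 ^ m ≤ armWeight m (q ∘ suc) (h ∘ suc)
  rest = begin
    2 * (t ∸ c) * 2 ^ m            ≡⟨ assoc2 (t ∸ c) (2 ^ m) ⟩
    (t ∸ c) * 2 ^ suc m            ≡⟨ *-distribʳ-∸ (2 ^ suc m) t c ⟩
    t * 2 ^ suc m ∸ c * 2 ^ suc m  ≤⟨ m≤n+o⇒m∸n≤o (t * 2 ^ suc m) (c * 2 ^ suc m)
                                        (≤-trans t≤ (+-monoˡ-≤ _ head≤)) ⟩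
    armWeight m (q ∘ suc) (h ∘ suc) ∎

-- Sums over segments of a cycle

sumUpTo : ℕ → (ℕ → ℕ) → ℕ
sumUpTo n f = sum {n} (f ∘ toℕ)

sumUpTo-+ : ∀ m n f → sumUpTo (m + n) f ≡ sumUpTo m f + sumUpTo n (λ j → f (m + j))
sumUpTo-+ zero    n f = refl
sumUpTo-+ (suc m) n f = trans (cong (f 0 +_) (sumUpTo-+ m n (f ∘ suc))) (sym (+-assoc (f 0) _ _))

sumUpTo-suc : ∀ n f → sumUpTo (suc n) f ≡ sumUpTo n f + f n
sumUpTo-suc zero    f = +-comm (f 0) 0
sumUpTo-suc (suc n) f = trans (cong (f 0 +_) (sumUpTo-suc n (f ∘ suc))) (sym (+-assoc (f 0) _ _))

sumUpTo-monoˡ : ∀ {m n} f → m ≤ n → sumUpTo m f ≤ sumUpTo n f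
sumUpTo-monoˡ f z≤n       = z≤n
sumUpTo-monoˡ f (s≤s m≤n) = +-monoʳ-≤ (f 0) (sumUpTo-monoˡ (f ∘ suc) m≤n)

sumUpTo-reverse : ∀ n f → sumUpTo (suc n) (λ j → f (n ∸ j)) ≡ sumUpTo (suc n) f
sumUpTo-reverse zero    f = refl
sumUpTo-reverse (suc n) f = begin
  f (suc n) + sumUpTo (suc n) (λ j → f (n ∸ j))  ≡⟨ cong (f (suc n) +_) (sumUpTo-reverse n f) ⟩
  f (suc n) + sumUpTo (suc n) f                  ≡⟨ +-comm (f (suc n)) _ ⟩
  sumUpTo (suc n) f + f (suc n)                  ≡⟨ sym (sumUpTo-suc (suc n) f) ⟩
  sumUpTo (suc (suc n)) f                        ∎
  where open ≡-Reasoning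

sum-↑ : ∀ m {n} (F : Fin (m + n) → ℕ) → sum F ≡ sum (λ i → F (i ↑ˡ n)) + sum (λ i → F (m ↑ʳ i))
sum-↑ zero    F = refl
sum-↑ (suc m) F = trans (cong (F Fin.zero +_) (sum-↑ m (F ∘ Fin.suc))) (sym (+-assoc (F Fin.zero) _ _))

sum-cast : ∀ {m n} (eq : m ≡ n) (F : Fin n → ℕ) → sum F ≡ sum (λ i → F (cast eq i))
sum-cast refl F = sum-cong-≗ λ i → cong F (sym (cast-is-id refl i))

module _ {k : ℕ} where

  -- Positions are not reduced modulo the length, so a step along the cycle is `suc` by definition
  -- and arcs may run past vertex zero.
  cyc : ℕ → Fin (suc k)
  cyc zero    = Fin.zero
  cyc (suc j) = cycNext (cyc j)

  toℕ-cycNext : ∀ (i : Fin (suc k)) → suc (toℕ i) < suc k → toℕ (cycNext i) ≡ suc (toℕ i)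
  toℕ-cycNext i i+1<k with suc (toℕ i) <? suc k
  ... | yes p = toℕ-fromℕ< p
  ... | no ¬p = contradiction i+1<k ¬p

  cycNext-last : ∀ (i : Fin (suc k)) → toℕ i ≡ k → cycNext i ≡ Fin.zero
  cycNext-last i i≡k with suc (toℕ i) <? suc k
  ... | yes p = contradiction (cong suc i≡k) (<⇒≢ p)
  ... | no _  = refl

  toℕ-cyc : ∀ {j} → j < suc k → toℕ (cyc j) ≡ j
  toℕ-cyc {zero}  _   = refl
  toℕ-cyc {suc j} j<k = trans (toℕ-cycNext (cyc j) (subst (λ x → suc x < suc k) (sym ih) j<k)) (cong suc ih)
    where ih = toℕ-cyc (≤-trans (n≤1+n _) j<k)

  cyc-toℕ : ∀ i → cyc (toℕ i) ≡ i
  cyc-toℕ i = toℕ-injective (toℕ-cyc (toℕ<n i))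

  cyc-period : ∀ j → cyc (j + suc k) ≡ cyc j
  cyc-period zero    = cycNext-last (cyc k) (toℕ-cyc ≤-refl)
  cyc-period (suc j) = cong cycNext (cyc-period j)

  -- Advancing the window by one drops the term at `cyc v` and adds the one at `cyc (v + suc k)`,
  -- which is the same vertex.
  sum-rotate : ∀ v (F : Fin (suc k) → ℕ) → sumUpTo (suc k) (λ j → F (cyc (v + j))) ≡ sum F
  sum-rotate zero    F = sum-cong-≗ λ i → cong F (cyc-toℕ i)
  sum-rotate (suc v) F = +-cancelʳ-≡ (F (cyc v)) _ _ (begin
    sumUpTo (suc k) (λ j → F (cyc (suc v + j))) + F (cyc v)
      ≡⟨ cong₂ _+_ (sum-cong-≗ {suc k} λ i → cong (F ∘ cyc) (sym (+-suc v (toℕ i)))) (cong (F ∘ cyc) (sym (+-identityʳ v))) ⟩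
    sumUpTo (suc k) (f ∘ suc) + f 0      ≡⟨ +-comm _ (f 0) ⟩
    sumUpTo (suc (suc k)) f              ≡⟨ sumUpTo-suc (suc k) f ⟩
    sumUpTo (suc k) f + f (suc k)        ≡⟨ cong₂ _+_ (sum-rotate v F) (cong F (cyc-period v)) ⟩
    sum F + F (cyc v)                    ∎)
    where
    open ≡-Reasoning
    f : ℕ → ℕ
    f j = F (cyc (v + j))

  -- A window no longer than the cycle meets each vertex at most once.
  sum-segment-≤ : ∀ v {n} (F : Fin (suc k) → ℕ) → n ≤ suc k → sumUpTo n (λ j → F (cyc (v + j))) ≤ sum F
  sum-segment-≤ v F n≤k = ≤-trans (sumUpTo-monoˡ (λ j → F (cyc (v + j))) n≤k) (≤-reflexive (sum-rotate v F))

  cycNext-≢ : 1 ≤ k → ∀ i → cycNext i ≢ i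
  cycNext-≢ 1≤k i next≡i with m≤n⇒m<n∨m≡n (toℕ≤pred[n] i)
  ... | inj₁ i<k = 1+n≢n (trans (sym (toℕ-cycNext i (s≤s i<k))) (cong toℕ next≡i))
  ... | inj₂ i≡k = <⇒≢ 1≤k (trans (cong toℕ (trans (sym (cycNext-last i i≡k)) next≡i)) i≡k)

-- Middle graphs of cycles

length-cycleEdges : ∀ k → List.length (cycleEdges k) ≡ k
length-cycleEdges k = trans (length-map (λ i → i , cycNext i) (List.allFin k)) (length-tabulate id)

lookup-map-tabulate : ∀ {A B : Set} {n} (f : Fin n → A) (g : A → B) .(eq : n ≡ List.length (List.map g (List.tabulate f))) i →
  List.lookup (List.map g (List.tabulate f)) (cast eq i) ≡ g (f i)
lookup-map-tabulate f g eq Fin.zero    = refl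
lookup-map-tabulate f g eq (Fin.suc i) = lookup-map-tabulate (f ∘ Fin.suc) g (suc-injective eq) i

module _ {k : ℕ} where

  -- The edge from `i` to `cycNext i`, cast because the number of edges equals `k` only
  -- propositionally.
  edge : Fin k → Fin (List.length (cycleEdges k))
  edge = cast (sym (length-cycleEdges k))

  lookup-edge : ∀ i → List.lookup (cycleEdges k) (edge i) ≡ (i , cycNext i)
  lookup-edge = lookup-map-tabulate id (λ i → i , cycNext i) (sym (length-cycleEdges k))

  U : Fin k → Fin (size (MC k))
  U i = i ↑ˡ List.length (cycleEdges k)

  E : Fin k → Fin (size (MC k))
  E i = k ↑ʳ edge i

  sum-MC : ∀ (F : Fin (size (MC k)) → ℕ) → sum F ≡ sum (F ∘ U) + sum (F ∘ E)
  sum-MC F = trans (sum-↑ k F) (cong (sum (F ∘ U) +_) (sum-cast (sym (length-cycleEdges k)) (λ e → F (k ↑ʳ e))))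

  vertex-view : ∀ r → (∃[ i ] r ≡ U i) ⊎ (∃[ i ] r ≡ E i)
  vertex-view r with splitAt k r in eq
  ... | inj₁ i = inj₁ (i , trans (sym (join-splitAt k _ r)) (cong (Fin.join k _) eq))
  ... | inj₂ e = inj₂ (cast (length-cycleEdges k) e ,
      trans (sym (join-splitAt k _ r)) (trans (cong (Fin.join k _) eq)
        (cong (k ↑ʳ_) (sym (cast-involutive (sym (length-cycleEdges k)) (length-cycleEdges k) e)))))

  private
    splitU : ∀ i → splitAt k (U i) ≡ inj₁ i
    splitU i = splitAt-↑ˡ k i _
    splitE : ∀ i → splitAt k (E i) ≡ inj₂ (edge i)
    splitE i = splitAt-↑ʳ k _ (edge i)

  U~E : ∀ {u i} → Endpoint u (i , cycNext i) → Adj (MC k) (U u) (E i)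
  U~E {u} {i} p = subst₂ (MAdj (cycleEdges k)) (sym (splitU u)) (sym (splitE i)) (subst (Endpoint u) (sym (lookup-edge i)) p)

  E~U : ∀ {u i} → Endpoint u (i , cycNext i) → Adj (MC k) (E i) (U u)
  E~U {u} {i} p = subst₂ (MAdj (cycleEdges k)) (sym (splitE i)) (sym (splitU u)) (subst (Endpoint u) (sym (lookup-edge i)) p)

  E~E : ∀ {i j} → i ≢ j → ShareEndpoint (i , cycNext i) (j , cycNext j) → Adj (MC k) (E i) (E j)
  E~E {i} {j} i≢j p = subst₂ (MAdj (cycleEdges k)) (sym (splitE i)) (sym (splitE j))
    ( (λ eq → i≢j (trans (sym (cast-involutive (length-cycleEdges k) (sym (length-cycleEdges k)) i))
                  (trans (cong (cast (length-cycleEdges k)) eq) (cast-involutive (length-cycleEdges k) (sym (length-cycleEdges k)) j))))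
    , subst₂ ShareEndpoint (sym (lookup-edge i)) (sym (lookup-edge j)) p)

-- Arms inside the middle graph of a cycle

IsHom : (G X : Graph) → (Fin (size G) → Fin (size X)) → Set
IsHom G X f = ∀ {u w} → Adj G u w → Adj X (f u) (f w)

⌈n/2⌉≤1+⌊n/2⌋ : ∀ n → ⌈ n /2⌉ ≤ suc ⌊ n /2⌋
⌈n/2⌉≤1+⌊n/2⌋ n = ⌊n/2⌋-mono (n≤1+n (suc n))

2⌊n/2⌋≤n : ∀ n → 2 * ⌊ n /2⌋ ≤ n
2⌊n/2⌋≤n n = begin
  ⌊ n /2⌋ + (⌊ n /2⌋ + 0)  ≡⟨ cong (⌊ n /2⌋ +_) (+-identityʳ _) ⟩
  ⌊ n /2⌋ + ⌊ n /2⌋        ≤⟨ +-monoʳ-≤ ⌊ n /2⌋ (⌊n/2⌋≤⌈n/2⌉ n) ⟩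
  ⌊ n /2⌋ + ⌈ n /2⌉        ≡⟨ ⌊n/2⌋+⌈n/2⌉≡n n ⟩
  n                        ∎
  where open ≤-Reasoning

n≤2⌊n/2⌋+1 : ∀ n → n ≤ 2 * ⌊ n /2⌋ + 1
n≤2⌊n/2⌋+1 n = begin
  n                        ≡⟨ sym (⌊n/2⌋+⌈n/2⌉≡n n) ⟩
  ⌊ n /2⌋ + ⌈ n /2⌉        ≤⟨ +-monoʳ-≤ ⌊ n /2⌋ (⌈n/2⌉≤1+⌊n/2⌋ n) ⟩
  ⌊ n /2⌋ + suc ⌊ n /2⌋    ≡⟨ eq ⌊ n /2⌋ ⟩
  2 * ⌊ n /2⌋ + 1          ∎
  where
  open ≤-Reasoning
  eq : ∀ h → h + suc h ≡ 2 * h + 1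
  eq = solve-∀

2⌈n/2⌉≤n+1 : ∀ n → ⌈ n /2⌉ + ⌈ n /2⌉ ≤ n + 1
2⌈n/2⌉≤n+1 n = begin
  ⌈ n /2⌉ + ⌈ n /2⌉      ≤⟨ +-monoˡ-≤ ⌈ n /2⌉ (⌈n/2⌉≤1+⌊n/2⌋ n) ⟩
  suc (⌊ n /2⌋ + ⌈ n /2⌉) ≡⟨ cong suc (⌊n/2⌋+⌈n/2⌉≡n n) ⟩
  suc n                  ≡⟨ +-comm 1 n ⟩
  n + 1                  ∎
  where open ≤-Reasoning

-- Each of the first `m` layers loses at most the one odd pebble of its pendant vertex; in the last
-- layer, where a pair counts once, `⌈ p m /2⌉` is lost.
armWeight-≥ : ∀ m q p →
  sumUpTo (suc m) q + sumUpTo (suc m) p ≤ armWeight m q (⌊_/2⌋ ∘ p) + ⌈ p m /2⌉ + m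
armWeight-≥ zero q p = ≤-reflexive (begin
  q 0 + 0 + (p 0 + 0)                  ≡⟨ cong₂ _+_ (+-identityʳ (q 0)) (+-identityʳ (p 0)) ⟩
  q 0 + p 0                            ≡⟨ cong (q 0 +_) (sym (⌊n/2⌋+⌈n/2⌉≡n (p 0))) ⟩
  q 0 + (⌊ p 0 /2⌋ + ⌈ p 0 /2⌉)        ≡⟨ sym (+-assoc (q 0) _ _) ⟩
  q 0 + ⌊ p 0 /2⌋ + ⌈ p 0 /2⌉          ≡⟨ sym (+-identityʳ _) ⟩
  q 0 + ⌊ p 0 /2⌋ + ⌈ p 0 /2⌉ + 0      ∎)
  where open ≡-Reasoning
armWeight-≥ (suc m) q p = begin
  q 0 + sumUpTo (suc m) (q ∘ suc) + (p 0 + sumUpTo (suc m) (p ∘ suc))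
    ≡⟨ eq₁ (q 0) (sumUpTo (suc m) (q ∘ suc)) (p 0) (sumUpTo (suc m) (p ∘ suc)) ⟩
  q 0 + p 0 + (sumUpTo (suc m) (q ∘ suc) + sumUpTo (suc m) (p ∘ suc))
    ≤⟨ +-mono-≤ (+-monoʳ-≤ (q 0) (n≤2⌊n/2⌋+1 (p 0))) (armWeight-≥ m (q ∘ suc) (p ∘ suc)) ⟩
  q 0 + (2 * ⌊ p 0 /2⌋ + 1) + (armWeight m (q ∘ suc) (⌊_/2⌋ ∘ p ∘ suc) + ⌈ p (suc m) /2⌉ + m)
    ≡⟨ eq₂ (q 0) (2 * ⌊ p 0 /2⌋) (armWeight m (q ∘ suc) (⌊_/2⌋ ∘ p ∘ suc)) ⌈ p (suc m) /2⌉ m ⟩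
  q 0 + 2 * ⌊ p 0 /2⌋ + armWeight m (q ∘ suc) (⌊_/2⌋ ∘ p ∘ suc) + ⌈ p (suc m) /2⌉ + suc m ∎
  where
  open ≤-Reasoning
  eq₁ : ∀ a b c d → a + b + (c + d) ≡ a + c + (b + d)
  eq₁ = solve-∀
  eq₂ : ∀ a b c d e → a + (b + 1) + (c + d + e) ≡ a + b + c + d + suc e
  eq₂ = solve-∀

module _ {k : ℕ} {X : Graph} (f : Fin (size (MC k)) → Fin (size X)) (hom : IsHom (MC k) X f)
         (D : Distribution (MC k)) where

  -- Quantifying over all `F` says that no vertex is used twice, so the arm's pebbles are really
  -- present. The multiplicity `c` is used with the values 1, to set aside the pebbles on `U v`, and
  -- 0, to ignore them.
  arm-within : ∀ m (ie iu : ℕ → Fin k) c v t →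
    (∀ j → j < m → Adj (MC k) (E (ie (suc j))) (E (ie j))) →
    (∀ j → j ≤ m → Adj (MC k) (U (iu j)) (E (ie j))) →
    (∀ F → sumUpTo (suc m) (F ∘ ie) ≤ sum F) →
    (∀ F → sumUpTo (suc m) (F ∘ iu) + c * F v ≤ sum F) →
    t * 2 ^ m ≤ armWeight m (D ∘ E ∘ ie) (⌊_/2⌋ ∘ D ∘ U ∘ iu) →
    X ⊢ pushforward f D ⇝ t • f (E (ie 0)) ⊕ (c * D (U v)) • f (U v)
  arm-within m ie iu c v t E~ U~ inE inU t≤ =
    ⇝-resp-≤ within (λ z → ≤-refl)
      (⇝-frame ((c * D (U v)) • f (U v))
        (arm-⇝ {X} m (f ∘ E ∘ ie) (f ∘ U ∘ iu) (D ∘ E ∘ ie) (⌊_/2⌋ ∘ D ∘ U ∘ iu) t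
          (λ j j<m → hom (E~ j j<m)) (λ j j≤m → hom (U~ j j≤m)) t≤))
    where
    within : ∀ z → arm m (f ∘ E ∘ ie) (f ∘ U ∘ iu) (D ∘ E ∘ ie) (⌊_/2⌋ ∘ D ∘ U ∘ iu) z
                   + c * D (U v) * δ (f (U v)) z ≤ pushforward f D z
    within z = begin
      arm m (f ∘ E ∘ ie) (f ∘ U ∘ iu) (D ∘ E ∘ ie) (⌊_/2⌋ ∘ D ∘ U ∘ iu) z + c * D (U v) * δ (f (U v)) z
        -- The odd pebbles on the original vertices are discarded here.
        ≤⟨ +-mono-≤ (sum-mono {suc m} λ i → +-monoʳ-≤ (G (E (ie (toℕ i))))
                       (*-monoˡ-≤ (δ (f (U (iu (toℕ i)))) z) (2⌊n/2⌋≤n (D (U (iu (toℕ i)))))))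
                    (≤-reflexive (*-assoc c _ _)) ⟩
      sumUpTo (suc m) (λ j → G (E (ie j)) + G (U (iu j))) + c * G (U v)
        ≡⟨ cong (_+ c * G (U v)) (∑-distrib-+ {suc m} (G-E ∘ ie ∘ toℕ) (G-U ∘ iu ∘ toℕ)) ⟩
      sumUpTo (suc m) (G-E ∘ ie) + sumUpTo (suc m) (G-U ∘ iu) + c * G (U v)
        ≡⟨ +-assoc (sumUpTo (suc m) (G-E ∘ ie)) _ _ ⟩
      sumUpTo (suc m) (G-E ∘ ie) + (sumUpTo (suc m) (G-U ∘ iu) + c * G (U v))
        ≤⟨ +-mono-≤ (inE G-E) (inU G-U) ⟩
      sum G-E + sum G-U  ≡⟨ +-comm (sum G-E) (sum G-U) ⟩
      sum G-U + sum G-E  ≡⟨ sym (sum-MC {k} G) ⟩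
      sum G ∎
      where
      open ≤-Reasoning
      G : Fin (size (MC k)) → ℕ
      G a = D a * δ (f a) z
      G-U G-E : Fin k → ℕ
      G-U i = G (U i)
      G-E i = G (E i)

  -- The target is one step beyond the arm: the `d` pebbles already there are kept, and only `t ∸ d`
  -- more have to be brought, at two pebbles each on the first vertex of the arm.
  arm-to-U : ∀ m (ie iu : ℕ → Fin k) v t → Adj (MC k) (E (ie 0)) (U v) →
    (∀ j → j < m → Adj (MC k) (E (ie (suc j))) (E (ie j))) →
    (∀ j → j ≤ m → Adj (MC k) (U (iu j)) (E (ie j))) →
    (∀ F → sumUpTo (suc m) (F ∘ ie) ≤ sum F) →
    (∀ F → sumUpTo (suc m) (F ∘ iu) + F v ≤ sum F) →
    t * 2 ^ suc m ≤ D (U v) + armWeight m (D ∘ E ∘ ie) (⌊_/2⌋ ∘ D ∘ U ∘ iu) →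
    X ⊢ pushforward f D ⇝ t • f (U v)
  arm-to-U m ie iu v t E~Uv E~ U~ inE inU t≤ =
    ⇝-trans (arm-within m ie iu 1 v (2 * s) E~ U~ inE
               (λ F → subst (λ x → sumUpTo (suc m) (F ∘ iu) + x ≤ sum F) (sym (+-identityʳ (F v))) (inU F)) s≤)
      (⇝-resp-≤ (λ z → ≤-refl) enough (⇝-frame ((1 * D (U v)) • f (U v)) (⇝-moves s (hom E~Uv))))
    where
    open ≤-Reasoning
    d = D (U v)
    s = t ∸ d
    W = armWeight m (D ∘ E ∘ ie) (⌊_/2⌋ ∘ D ∘ U ∘ iu)
    enough : ∀ z → (t • f (U v)) z ≤ (s • f (U v) ⊕ (1 * d) • f (U v)) z
    enough z = begin
      t * δ (f (U v)) z            ≤⟨ *-monoˡ-≤ (δ (f (U v)) z) (m≤n+m∸n t d) ⟩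
      (d + s) * δ (f (U v)) z      ≡⟨ eq d s (δ (f (U v)) z) ⟩
      s * δ (f (U v)) z + 1 * d * δ (f (U v)) z ∎
      where
      eq : ∀ d s e → (d + s) * e ≡ s * e + 1 * d * e
      eq = solve-∀
    s≤ : 2 * s * 2 ^ m ≤ W
    s≤ = begin
      2 * s * 2 ^ m                  ≡⟨ eq s (2 ^ m) ⟩
      s * 2 ^ suc m                  ≡⟨ *-distribʳ-∸ (2 ^ suc m) t d ⟩
      -- A pebble already on the target saves `2 ^ suc m`, but the hypothesis credits it with 1
      -- only.
      t * 2 ^ suc m ∸ d * 2 ^ suc m  ≤⟨ ∸-monoʳ-≤ (t * 2 ^ suc m) (≤-trans (≤-reflexive (sym (*-identityʳ d))) (*-monoʳ-≤ d (m^n>0 2 (suc m)))) ⟩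
      t * 2 ^ suc m ∸ d              ≤⟨ m≤n+o⇒m∸n≤o (t * 2 ^ suc m) d t≤ ⟩
      W                              ∎
      where
      eq : ∀ s p → 2 * s * p ≡ s * (2 * p)
      eq = solve-∀

-- Comparing the two arcs that lead to a target

larger-half : ∀ {T} a b → 2 * T ≤ a + b → T ≤ a ⊎ T ≤ b
larger-half {T} a b 2T≤ with T ≤? a | T ≤? b
... | yes T≤a | _       = inj₁ T≤a
... | _       | yes T≤b = inj₂ T≤b
... | no T≰a  | no T≰b  = contradiction 2T≤ (<⇒≱ (begin-strict
  a + b        <⟨ +-mono-< (≰⇒> T≰a) (≰⇒> T≰b) ⟩
  T + T        ≡⟨ cong (T +_) (sym (+-identityʳ T)) ⟩
  2 * T        ∎))
  where open ≤-Reasoning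

-- `A`, `B` count pebbles on the original and `C`, `D` on the new vertices of the two halves of the
-- cycle; `p₀` belongs to the target, `pₙ` to its antipode. The antipode ends both arms and each
-- weight counts half of it, so it loses at most one pebble in all; each arm loses at most `n'`
-- more.
weights-U : ∀ {T n' A B C D S p₀ pₙ WL WR} → T + 2 * suc n' ≤ A + B + (C + D) → A + pₙ ≡ p₀ + S →
  C + S ≤ WL + ⌈ pₙ /2⌉ + n' → D + B ≤ WR + ⌈ pₙ /2⌉ + n' → T ≤ (p₀ + WL) + (p₀ + WR)
weights-U {T} {n'} {A} {B} {C} {D} {S} {p₀} {pₙ} {WL} {WR} total wrap left right =
  +-cancelʳ-≤ (2 * suc n' + pₙ) _ _ (begin
    T + (2 * suc n' + pₙ)            ≡⟨ sym (+-assoc T _ pₙ) ⟩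
    T + 2 * suc n' + pₙ              ≤⟨ +-monoˡ-≤ pₙ total ⟩
    A + B + (C + D) + pₙ             ≡⟨ e₁ A B C D pₙ ⟩
    (A + pₙ) + (C + (D + B))         ≡⟨ cong (_+ (C + (D + B))) wrap ⟩
    (p₀ + S) + (C + (D + B))         ≡⟨ e₂ p₀ S C (D + B) ⟩
    p₀ + ((C + S) + (D + B))         ≤⟨ +-monoʳ-≤ p₀ (+-mono-≤ left right) ⟩
    p₀ + ((WL + ⌈ pₙ /2⌉ + n') + (WR + ⌈ pₙ /2⌉ + n'))
      ≡⟨ e₃ p₀ WL WR ⌈ pₙ /2⌉ n' ⟩
    p₀ + WL + WR + 2 * n' + (⌈ pₙ /2⌉ + ⌈ pₙ /2⌉)
      ≤⟨ +-monoʳ-≤ (p₀ + WL + WR + 2 * n') (2⌈n/2⌉≤n+1 pₙ) ⟩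
    -- Slack: the loss is `2 * n' + 1` against an allowance of `2 * suc n'`, and the target's own
    -- pebbles appear in both summands.
    p₀ + WL + WR + 2 * n' + (pₙ + 1)                ≤⟨ m≤m+n _ (suc p₀) ⟩
    p₀ + WL + WR + 2 * n' + (pₙ + 1) + suc p₀       ≡⟨ e₄ p₀ WL WR n' pₙ ⟩
    (p₀ + WL) + (p₀ + WR) + (2 * suc n' + pₙ)       ∎)
  where
  open ≤-Reasoning
  e₁ : ∀ a b c d x → a + b + (c + d) + x ≡ (a + x) + (c + (d + b))
  e₁ = solve-∀
  e₂ : ∀ a b c d → (a + b) + (c + d) ≡ a + ((c + b) + d)
  e₂ = solve-∀
  e₃ : ∀ a l r h m → a + ((l + h + m) + (r + h + m)) ≡ a + l + r + 2 * m + (h + h)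
  e₃ = solve-∀
  e₄ : ∀ a l r m x → a + l + r + 2 * m + (x + 1) + suc a ≡ (a + l) + (a + r) + (2 * suc m + x)
  e₄ = solve-∀

-- For a new vertex as target the arms overlap in the original vertices at positions `n` and
-- `n + 1`. Each is last on one arm and inner on the other, so its second copy pays for what is lost
-- where it is last.
weights-E : ∀ {T n A B C D C⁺ D⁺ S B⁺ p₀ pₙ pₙ₊₁ WL WR} → T + 2 * n ≤ A + B + (C + D) →
  A + pₙ + pₙ₊₁ ≡ p₀ + S → B + p₀ ≡ B⁺ → C ≤ C⁺ → D ≤ D⁺ →
  C⁺ + S ≤ WL + ⌈ pₙ₊₁ /2⌉ + n → D⁺ + B⁺ ≤ WR + ⌈ pₙ /2⌉ + n → T ≤ WL + WR
weights-E {T} {n} {A} {B} {C} {D} {C⁺} {D⁺} {S} {_} {p₀} {pₙ} {pₙ₊₁} {WL} {WR} total wrapL refl C≤ D≤ left right =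
  +-cancelʳ-≤ (2 * n + (pₙ + pₙ₊₁)) _ _ (+-cancelʳ-≤ p₀ _ _ (begin
    T + (2 * n + (pₙ + pₙ₊₁)) + p₀             ≡⟨ cong (_+ p₀) (sym (+-assoc T _ _)) ⟩
    T + 2 * n + (pₙ + pₙ₊₁) + p₀               ≤⟨ +-monoˡ-≤ p₀ (+-monoˡ-≤ (pₙ + pₙ₊₁) total) ⟩
    A + B + (C + D) + (pₙ + pₙ₊₁) + p₀         ≡⟨ e₁ A B C D pₙ pₙ₊₁ p₀ ⟩
    C + D + (B + p₀) + (A + pₙ + pₙ₊₁)         ≡⟨ cong (C + D + (B + p₀) +_) wrapL ⟩
    C + D + (B + p₀) + (p₀ + S)                ≤⟨ +-monoˡ-≤ (p₀ + S) (+-monoˡ-≤ (B + p₀) (+-mono-≤ C≤ D≤)) ⟩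
    C⁺ + D⁺ + (B + p₀) + (p₀ + S)              ≡⟨ e₂ C⁺ D⁺ (B + p₀) p₀ S ⟩
    (C⁺ + S) + (D⁺ + (B + p₀)) + p₀            ≤⟨ +-monoˡ-≤ p₀ (+-mono-≤ left right) ⟩
    (WL + ⌈ pₙ₊₁ /2⌉ + n) + (WR + ⌈ pₙ /2⌉ + n) + p₀
      ≤⟨ +-monoˡ-≤ p₀ (+-mono-≤ (+-monoˡ-≤ n (+-monoʳ-≤ WL (⌈n/2⌉≤n pₙ₊₁))) (+-monoˡ-≤ n (+-monoʳ-≤ WR (⌈n/2⌉≤n pₙ)))) ⟩
    (WL + pₙ₊₁ + n) + (WR + pₙ + n) + p₀       ≡⟨ e₃ WL WR n pₙ pₙ₊₁ p₀ ⟩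
    WL + WR + (2 * n + (pₙ + pₙ₊₁)) + p₀       ∎))
  where
  open ≤-Reasoning
  e₁ : ∀ a b c d x y z → a + b + (c + d) + (x + y) + z ≡ c + d + (b + z) + (a + x + y)
  e₁ = solve-∀
  e₂ : ∀ c d b z s → c + d + b + (z + s) ≡ (c + s) + (d + b) + z
  e₂ = solve-∀
  e₃ : ∀ l r m x y z → (l + y + m) + (r + x + m) + z ≡ l + r + (2 * m + (x + y)) + z
  e₃ = solve-∀

module _ {n' : ℕ} {X : Graph} (f : Fin (size (MC (2 * suc n'))) → Fin (size X))
         (hom : IsHom (MC (2 * suc n')) X f) (D : Distribution (MC (2 * suc n'))) (v t : ℕ)
         (t≤ : t * 2 ^ suc (suc n') + 2 * suc n' ≤ sum D) where

  private
    n = suc n'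
    k' = n' + (n + 0)
    c : ℕ → Fin (2 * n)
    c = cyc {k'}
    p q : ℕ → ℕ
    p j = D (U (c (v + j)))
    q j = D (E (c (v + j)))

    halves : ∀ F → sum F ≡ sumUpTo n (λ j → F (c (v + j))) + sumUpTo n (λ j → F (c (v + (n + j))))
    halves F = begin
      sum F                                   ≡⟨ sym (sum-rotate v F) ⟩
      sumUpTo (n + (n + 0)) (λ j → F (c (v + j))) ≡⟨ cong (λ x → sumUpTo (n + x) (λ j → F (c (v + j)))) (+-identityʳ n) ⟩
      sumUpTo (n + n) (λ j → F (c (v + j)))   ≡⟨ sumUpTo-+ n n (λ j → F (c (v + j))) ⟩
      sumUpTo n (λ j → F (c (v + j))) + sumUpTo n (λ j → F (c (v + (n + j)))) ∎
      where open ≡-Reasoning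

    period : c (v + (n + n)) ≡ c v
    period = trans (cong (λ x → c (v + (n + x))) (sym (+-identityʳ n))) (cyc-period v)

    total≤ : t * 2 ^ suc n + 2 * n ≤ sumUpTo n p + sumUpTo n (p ∘ (n +_)) + (sumUpTo n q + sumUpTo n (q ∘ (n +_)))
    total≤ = ≤-trans t≤ (≤-reflexive (trans (sum-MC {2 * n} D) (cong₂ _+_ (halves (D ∘ U)) (halves (D ∘ E)))))

    1≤k' : 1 ≤ k'
    1≤k' = ≤-trans (s≤s z≤n) (m≤n+m (n + 0) n')

    E-suc~E : ∀ {i j} → i ≡ suc j → Adj (MC (2 * n)) (E (c i)) (E (c j))
    E-suc~E {_} {j} refl = E~E (cycNext-≢ 1≤k' (c j)) (inj₁ (inj₂ refl))

    E~E-suc : ∀ {i j} → i ≡ suc j → Adj (MC (2 * n)) (E (c j)) (E (c i))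
    E~E-suc {_} {j} refl = E~E (λ eq → cycNext-≢ 1≤k' (c j) (sym eq)) (inj₂ (inj₁ refl))

    U-suc~E : ∀ {i j} → i ≡ suc j → Adj (MC (2 * n)) (U (c i)) (E (c j))
    U-suc~E refl = U~E (inj₂ refl)

    suc-∸ : ∀ {m j} → j < m → v + (n + (m ∸ j)) ≡ suc (v + (n + (m ∸ suc j)))
    suc-∸ {m} {j} j<m = begin
      v + (n + (m ∸ j))            ≡⟨ cong (λ x → v + (n + x)) (+-∸-assoc 1 {m} {suc j} j<m) ⟩
      v + (n + suc (m ∸ suc j))    ≡⟨ cong (v +_) (+-suc n _) ⟩
      v + suc (n + (m ∸ suc j))    ≡⟨ +-suc v _ ⟩
      suc (v + (n + (m ∸ suc j)))  ∎
      where open ≡-Reasoning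

    -- The backward arc ends at position `v + n`. It starts just before the target vertex when `m`
    -- is `n'`, and at `v + 2n`, that is at `v` again, when `m` is `n`.
    right : ℕ → ℕ → Fin (2 * n)
    right m j = c (v + (n + (m ∸ j)))

    -- The two arms run in opposite directions from the target at position v and
    -- meet at position v + n.
    weightL weightR : ℕ → ℕ
    weightL m = armWeight m q (⌊_/2⌋ ∘ p ∘ suc)
    weightR m = armWeight m (D ∘ E ∘ right m) (⌊_/2⌋ ∘ D ∘ U ∘ right m)

    weightR-≥ : ∀ m → sumUpTo (suc m) (q ∘ (n +_)) + sumUpTo (suc m) (p ∘ (n +_)) ≤ weightR m + ⌈ p n /2⌉ + m
    weightR-≥ m = begin
      sumUpTo (suc m) (q ∘ (n +_)) + sumUpTo (suc m) (p ∘ (n +_))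
        ≡⟨ sym (cong₂ _+_ (sumUpTo-reverse m (q ∘ (n +_))) (sumUpTo-reverse m (p ∘ (n +_)))) ⟩
      sumUpTo (suc m) (λ j → q (n + (m ∸ j))) + sumUpTo (suc m) (λ j → p (n + (m ∸ j)))
        ≤⟨ armWeight-≥ m (D ∘ E ∘ right m) (D ∘ U ∘ right m) ⟩
      weightR m + ⌈ p (n + (m ∸ m)) /2⌉ + m
        ≡⟨ cong (λ x → weightR m + ⌈ p x /2⌉ + m) (trans (cong (n +_) (n∸n≡0 m)) (+-identityʳ n)) ⟩
      weightR m + ⌈ p n /2⌉ + m ∎
      where open ≤-Reasoning

    right-within : ∀ m → m ≤ n → ∀ F → sumUpTo (suc m) (F ∘ right m) ≤ sum F
    right-within m m≤n F = begin
      sumUpTo (suc m) (F ∘ right m)                     ≡⟨ sumUpTo-reverse m (λ j → F (c (v + (n + j)))) ⟩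
      sumUpTo (suc m) (λ j → F (c (v + (n + j))))       ≡⟨ sum-cong-≗ {suc m} (λ i → cong (F ∘ c) (sym (+-assoc v n (toℕ i)))) ⟩
      sumUpTo (suc m) (λ j → F (c (v + n + j)))         ≤⟨ sum-segment-≤ (v + n) F (s≤s (≤-trans m≤n (≤-trans (≤-reflexive (sym (+-identityʳ n))) (m≤n+m (n + 0) n')))) ⟩
      sum F                                             ∎
      where open ≤-Reasoning

    2n≥1+n : suc n ≤ 2 * n
    2n≥1+n = s≤s (≤-trans (≤-reflexive (sym (+-identityʳ n))) (m≤n+m (n + 0) n'))

    c-0 : c (v + 0) ≡ c v
    c-0 = cong c (+-identityʳ v)

    double : t * 2 ^ suc n ≡ 2 * (t * 2 ^ n)
    double = e t (2 ^ n)
      where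
      e : ∀ t x → t * (2 * x) ≡ 2 * (t * x)
      e = solve-∀

    weights-at-U : 2 * (t * 2 ^ n) ≤ (p 0 + weightL n') + (p 0 + weightR n')
    weights-at-U = subst (_≤ (p 0 + weightL n') + (p 0 + weightR n')) double
      (weights-U {A = sumUpTo n p} {sumUpTo n (p ∘ (n +_))} {sumUpTo n q} {sumUpTo n (q ∘ (n +_))} {sumUpTo n (p ∘ suc)} {p 0} {p n} total≤ (sym (sumUpTo-suc n p)) (armWeight-≥ n' q (p ∘ suc)) (weightR-≥ n'))

    weights-at-E : 2 * (t * 2 ^ n) ≤ weightL n + weightR n
    weights-at-E = subst (_≤ weightL n + weightR n) double
      (weights-E {n = n} {sumUpTo n p} {sumUpTo n (p ∘ (n +_))} {sumUpTo n q} {sumUpTo n (q ∘ (n +_))}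
        {sumUpTo (suc n) q} {sumUpTo (suc n) (q ∘ (n +_))} {sumUpTo (suc n) (p ∘ suc)} {sumUpTo (suc n) (p ∘ (n +_))} {p 0} {p n} {p (suc n)} {weightL n} {weightR n} total≤
        (trans (cong (_+ p (suc n)) (sym (sumUpTo-suc n p))) (sym (sumUpTo-suc (suc n) p)))
        -- The pebbles at position 0 are those at position `2n`, so they extend the second half by
        -- one term.
        (trans (cong (λ x → sumUpTo n (p ∘ (n +_)) + D (U x)) (trans c-0 (sym period))) (sym (sumUpTo-suc n (p ∘ (n +_)))))
        (sumUpTo-monoˡ q (n≤1+n n)) (sumUpTo-monoˡ (q ∘ (n +_)) (n≤1+n n))
        (armWeight-≥ n q (p ∘ suc)) (weightR-≥ n))

    leftU-within : ∀ F → sumUpTo n (λ j → F (c (v + suc j))) + F (c v) ≤ sum F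
    leftU-within F = begin
      sumUpTo n (λ j → F (c (v + suc j))) + F (c v)        ≡⟨ +-comm _ (F (c v)) ⟩
      F (c v) + sumUpTo n (λ j → F (c (v + suc j)))        ≡⟨ cong (λ x → F x + sumUpTo n (λ j → F (c (v + suc j)))) (sym c-0) ⟩
      sumUpTo (suc n) (λ j → F (c (v + j)))                ≤⟨ sum-segment-≤ v F 2n≥1+n ⟩
      sum F                                                ∎
      where open ≤-Reasoning

    -- The arm together with the target fills the `n + 1` consecutive positions from `v + n` to
    -- `v + 2n`.
    rightU-within : ∀ F → sumUpTo n (F ∘ right n') + F (c v) ≤ sum F
    rightU-within F = begin
      sumUpTo n (F ∘ right n') + F (c v)
        ≡⟨ cong₂ _+_ (sumUpTo-reverse n' g) (cong F (sym period)) ⟩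
      sumUpTo n g + g n                    ≡⟨ sym (sumUpTo-suc n g) ⟩
      sumUpTo (suc n) g                    ≡⟨ sym (sumUpTo-reverse n g) ⟩
      sumUpTo (suc n) (F ∘ right n)        ≤⟨ right-within n ≤-refl F ⟩
      sum F                                ∎
      where
      open ≤-Reasoning
      g : ℕ → ℕ
      g j = F (c (v + (n + j)))

    from-left-U : t * 2 ^ n ≤ p 0 + weightL n' → X ⊢ pushforward f D ⇝ t • f (U (c v))
    from-left-U le = arm-to-U f hom D n' (λ j → c (v + j)) (λ j → c (v + suc j)) (c v) t
      (E~U (inj₁ (sym c-0)))
      (λ j _ → E-suc~E (+-suc v j)) (λ j _ → U-suc~E (+-suc v j))
      (λ F → sum-segment-≤ v F (m≤m+n n (n + 0)))
      leftU-within
      (subst (λ x → t * 2 ^ n ≤ D (U x) + weightL n') c-0 le)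

    v~right : c v ≡ cycNext (right n' 0)
    v~right = trans (sym period) (cong c (trans (cong (v +_) (+-suc n n')) (+-suc v (n + n'))))

    from-right-U : t * 2 ^ n ≤ p 0 + weightR n' → X ⊢ pushforward f D ⇝ t • f (U (c v))
    from-right-U le = arm-to-U f hom D n' (right n') (right n') (c v) t
      (E~U (inj₂ v~right))
      (λ j j<n' → E~E-suc (suc-∸ j<n')) (λ j _ → U~E {u = right n' j} (inj₁ refl))
      (right-within n' (n≤1+n n'))
      rightU-within
      (subst (λ x → t * 2 ^ n ≤ D (U x) + weightR n') c-0 le)

    from-left-E : t * 2 ^ n ≤ weightL n → X ⊢ pushforward f D ⇝ t • f (E (c v))
    from-left-E le = subst (λ i → X ⊢ pushforward f D ⇝ t • f (E i)) c-0
      (⇝-resp-≤ (λ z → ≤-refl) (λ z → m≤m+n _ _)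
        -- Multiplicity 0: the target is the first vertex of the arm, so nothing is set aside.
        (arm-within f hom D n (λ j → c (v + j)) (λ j → c (v + suc j)) 0 (c v) t
          (λ j _ → E-suc~E (+-suc v j)) (λ j _ → U-suc~E (+-suc v j))
          (λ F → sum-segment-≤ v F 2n≥1+n)
          (λ F → ≤-trans (+-monoʳ-≤ _ z≤n) (leftU⁺ F))
          le))
      where
      leftU⁺ : ∀ F → sumUpTo (suc n) (λ j → F (c (v + suc j))) + 0 ≤ sum F
      leftU⁺ F = begin
        sumUpTo (suc n) (λ j → F (c (v + suc j))) + 0  ≡⟨ +-identityʳ _ ⟩
        sumUpTo (suc n) (λ j → F (c (v + suc j)))      ≡⟨ sum-cong-≗ {suc n} (λ i → cong (F ∘ c) (+-suc v (toℕ i))) ⟩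
        sumUpTo (suc n) (λ j → F (c (suc v + j)))      ≤⟨ sum-segment-≤ (suc v) F 2n≥1+n ⟩
        sum F                                          ∎
        where open ≤-Reasoning

    from-right-E : t * 2 ^ n ≤ weightR n → X ⊢ pushforward f D ⇝ t • f (E (c v))
    from-right-E le = subst (λ i → X ⊢ pushforward f D ⇝ t • f (E i)) period
      (⇝-resp-≤ (λ z → ≤-refl) (λ z → m≤m+n _ _)
        (arm-within f hom D n (right n) (right n) 0 (c v) t
          (λ j j<n → E~E-suc (suc-∸ j<n)) (λ j _ → U~E {u = right n j} (inj₁ refl))
          (right-within n ≤-refl)
          (λ F → ≤-trans (≤-reflexive (+-identityʳ _)) (right-within n ≤-refl F))
          le))

  ⇝-U : X ⊢ pushforward f D ⇝ t • f (U (c v))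
  ⇝-U = [ from-left-U , from-right-U ]′ (larger-half (p 0 + weightL n') (p 0 + weightR n') weights-at-U)

  ⇝-E : X ⊢ pushforward f D ⇝ t • f (E (c v))
  ⇝-E = [ from-left-E , from-right-E ]′ (larger-half (weightL n) (weightR n) weights-at-E)

-- Stated for a homomorphism so that it serves the fibres of the product, the copy on which their
-- yield is collected, and, with `id`, a single middle graph.
pushforward-⇝ : ∀ {n'} {X : Graph} (f : Fin (size (MC (2 * suc n'))) → Fin (size X)) →
  IsHom (MC (2 * suc n')) X f → (D : Distribution (MC (2 * suc n'))) → ∀ r t →
  t * 2 ^ suc (suc n') + 2 * suc n' ≤ sum D → X ⊢ pushforward f D ⇝ t • f r
pushforward-⇝ {n'} {X} f hom D r t t≤ with vertex-view {2 * suc n'} r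
... | inj₁ (i , refl) = subst (λ i → X ⊢ pushforward f D ⇝ t • f (U i)) (cyc-toℕ i) (⇝-U f hom D (toℕ i) t t≤)
... | inj₂ (i , refl) = subst (λ i → X ⊢ pushforward f D ⇝ t • f (E i)) (cyc-toℕ i) (⇝-E f hom D (toℕ i) t t≤)

sum-const : ∀ n c → sum {n} (λ _ → c) ≡ n * c
sum-const zero    c = refl
sum-const (suc n) c = cong (c +_) (sum-const n c)

-- Products

-- The number of pebbles a fibre holding `P` is asked for, at price `N` each after a waste of `c`;
-- it is 0 if `P` is below `c`. At most `N + c - 1` pebbles remain unaccounted for.
quota : ∀ N c P → 0 < N → ∃[ t ] (t ≡ 0 ⊎ t * N + c ≤ P) × suc P ≤ t * N + (N + c)
quota N@(suc _) c P _ with c ≤? P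
... | no c≰P  = 0 , inj₁ refl , ≤-trans (≰⇒> c≰P) (m≤n+m c N)
... | yes c≤P = q , inj₂ lower , upper
  where
  open ≤-Reasoning
  q = (P ∸ c) / N
  r = (P ∸ c) % N
  P≡ : P ≡ r + q * N + c
  P≡ = trans (sym (m∸n+n≡m c≤P)) (cong (_+ c) (m≡m%n+[m/n]*n (P ∸ c) N))
  lower : q * N + c ≤ P
  lower = ≤-trans (+-monoˡ-≤ c (m≤n+m (q * N) r)) (≤-reflexive (sym P≡))
  upper : suc P ≤ q * N + (N + c)
  upper = begin
    suc P                ≡⟨ cong suc P≡ ⟩
    suc r + q * N + c    ≤⟨ +-monoˡ-≤ c (+-monoˡ-≤ (q * N) (m%n<n (P ∸ c) N)) ⟩
    N + q * N + c        ≡⟨ eq N (q * N) c ⟩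
    q * N + (N + c)      ∎
    where
    eq : ∀ a b c → a + b + c ≡ b + (a + c)
    eq = solve-∀

-- A lower bound for the pebbling number of `MC (2 * k)`, as `pebblingMC-≤` shows; it is two less
-- than the count `pushforward-⇝` asks for to deliver one pebble.
pebblingMC : ℕ → ℕ
pebblingMC k = 2 ^ suc k + 2 * pred k

size-MC : ∀ l → size (MC (2 * l)) ≡ 4 * l
size-MC l = trans (cong (2 * l +_) (length-cycleEdges (2 * l))) (eq l)
  where
  eq : ∀ l → 2 * l + 2 * l ≡ 4 * l
  eq = solve-∀

-- Arithmetic of the surplus

1+n≤2^n : ∀ n → suc n ≤ 2 ^ n
1+n≤2^n zero    = ≤-refl
1+n≤2^n (suc n) = begin
  1 + suc n        ≤⟨ +-mono-≤ (m^n>0 2 n) (1+n≤2^n n) ⟩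
  2 ^ n + 2 ^ n    ≡⟨ cong (2 ^ n +_) (sym (+-identityʳ (2 ^ n))) ⟩
  2 ^ suc n        ∎
  where open ≤-Reasoning

-- With `p = 4 + e` the right side is the `N` of the smaller cycle; a linear lower bound is all that
-- `slack` asks of it.
64+32e≤2^[6+e] : ∀ e → 64 + 32 * e ≤ 2 ^ suc (suc (4 + e))
64+32e≤2^[6+e] zero    = ≤-refl
64+32e≤2^[6+e] (suc e) = double (64+32e≤2^[6+e] e)
  where
  open ≤-Reasoning
  eq : ∀ e → 64 + 32 * suc e + (32 + 32 * e) ≡ 2 * (64 + 32 * e)
  eq = solve-∀
  double : ∀ {x} → 64 + 32 * e ≤ x → 64 + 32 * suc e ≤ 2 * x
  double {x} le = begin
    64 + 32 * suc e                     ≤⟨ m≤m+n (64 + 32 * suc e) (32 + 32 * e) ⟩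
    64 + 32 * suc e + (32 + 32 * e)     ≡⟨ eq e ⟩
    2 * (64 + 32 * e)                   ≤⟨ *-monoʳ-≤ 2 le ⟩
    2 * x                               ∎

-- With `r = p + 2 + d` the right side is the `M` of the larger cycle; the gap of two between the
-- indices yields the factor 4.
4N[1+d]≤2^[4+p+d] : ∀ p d → 4 * 2 ^ suc (suc p) * suc d ≤ 2 ^ suc (suc (suc (suc p) + d))
4N[1+d]≤2^[4+p+d] p d = begin
  4 * N * suc d            ≤⟨ *-monoʳ-≤ (4 * N) (1+n≤2^n d) ⟩
  4 * N * 2 ^ d            ≡⟨ eq N (2 ^ d) ⟩
  2 * (2 * (N * 2 ^ d))    ≡⟨ cong (λ x → 2 * (2 * x)) (sym (^-distribˡ-+-* 2 (suc (suc p)) d)) ⟩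
  2 ^ suc (suc (suc (suc p) + d)) ∎
  where
  open ≤-Reasoning
  N = 2 ^ suc (suc p)
  eq : ∀ N x → 4 * N * x ≡ 2 * (2 * (N * x))
  eq = solve-∀

-- Once `M` is replaced by `4 * N * suc d`, its term covers `A * N` and leaves a multiple of `N`,
-- which the bounds `64 ≤ N` and `13 + e ≤ N` make large enough to absorb the remaining product.
slack : ∀ e d {N M} → 64 + 32 * e ≤ N → 4 * N * suc d ≤ M →
  (4 * (7 + (e + d)) + 1) * N + 8 * (7 + (e + d)) * (5 + e) <
  2 * (4 + e) * M + 4 * (4 + e) * (6 + (e + d)) + 4 * (7 + (e + d))
slack e d {N} {M} N≥ M≥ = begin-strict
  A * N + 8 * (7 + (e + d)) * (5 + e)
    <⟨ +-monoʳ-< (A * N) main ⟩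
  A * N + ((3 * N + 4 * e * N + (28 + 8 * e) * d * N) + B)
    ≡⟨ sym (+-assoc (A * N) _ B) ⟩
  A * N + (3 * N + 4 * e * N + (28 + 8 * e) * d * N) + B
    ≡⟨ cong (_+ B) (sym (eq₁ e d N)) ⟩
  2 * (4 + e) * (4 * N * suc d) + B
    ≤⟨ +-monoˡ-≤ B (*-monoʳ-≤ (2 * (4 + e)) M≥) ⟩
  2 * (4 + e) * M + B
    ≡⟨ sym (+-assoc (2 * (4 + e) * M) _ _) ⟩
  2 * (4 + e) * M + 4 * (4 + e) * (6 + (e + d)) + 4 * (7 + (e + d)) ∎
  where
  open ≤-Reasoning
  A = 4 * (7 + (e + d)) + 1
  B = 4 * (4 + e) * (6 + (e + d)) + 4 * (7 + (e + d))
  eq₁ : ∀ e d N → 2 * (4 + e) * (4 * N * suc d) ≡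
    (4 * (7 + (e + d)) + 1) * N + (3 * N + 4 * e * N + (28 + 8 * e) * d * N)
  eq₁ = solve-∀
  eq₂ : ∀ e d → 8 * (7 + (e + d)) * (5 + e) + (36 + 8 * d + 4 * (e * d)) ≡
    3 * 64 + 4 * e * (13 + e) + (28 + 8 * e) * d * 1 + (4 * (4 + e) * (6 + (e + d)) + 4 * (7 + (e + d)))
  eq₂ = solve-∀
  64≤N : 64 ≤ N
  64≤N = ≤-trans (m≤m+n 64 (32 * e)) N≥
  13+e≤N : 13 + e ≤ N
  13+e≤N = ≤-trans (+-mono-≤ {13} {64} (m≤m+n 13 51) (m≤m+n e (31 * e))) N≥
  main : 8 * (7 + (e + d)) * (5 + e) < 3 * N + 4 * e * N + (28 + 8 * e) * d * N + B
  main = begin-strict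
    8 * (7 + (e + d)) * (5 + e)
      <⟨ m<m+n _ {36 + 8 * d + 4 * (e * d)} (s≤s z≤n) ⟩
    8 * (7 + (e + d)) * (5 + e) + (36 + 8 * d + 4 * (e * d))
      ≡⟨ eq₂ e d ⟩
    3 * 64 + 4 * e * (13 + e) + (28 + 8 * e) * d * 1 + B
      ≤⟨ +-monoˡ-≤ B (+-mono-≤ (+-mono-≤ (*-monoʳ-≤ 3 64≤N) (*-monoʳ-≤ (4 * e) 13+e≤N))
           (*-monoʳ-≤ ((28 + 8 * e) * d) (≤-trans (s≤s z≤n) 64≤N))) ⟩
    3 * N + 4 * e * N + (28 + 8 * e) * d * N + B ∎

slack-pr : ∀ {p r e d N M} → 4 + e ≡ p → suc (suc p) + d ≡ r → 64 + 32 * e ≤ N → 4 * N * suc d ≤ M →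
  (4 * suc r + 1) * N + 8 * suc r * suc p < 2 * p * M + 4 * p * r + 4 * suc r
slack-pr {e = e} {d} refl refl = slack e d

-- Expanding both sides and cancelling `(M + 2 * r) * N + N` leaves the hypothesis.
quota-loss-NM : ∀ N M p r →
  (4 * suc r + 1) * N + 8 * suc r * suc p < 2 * p * M + 4 * p * r + 4 * suc r →
  (M + 2 * suc r) * N + 4 * suc r * (N + 2 * suc p) < (N + 2 * p) * (M + 2 * r) + 4 * suc r + N
quota-loss-NM N M p r lt = begin-strict
  (M + 2 * suc r) * N + 4 * suc r * (N + 2 * suc p)
    ≡⟨ eq₁ N M p r ⟩
  (M + 2 * r) * N + N + ((4 * suc r + 1) * N + 8 * suc r * suc p)
    <⟨ +-monoʳ-< ((M + 2 * r) * N + N) lt ⟩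
  (M + 2 * r) * N + N + (2 * p * M + 4 * p * r + 4 * suc r)
    ≡⟨ eq₂ N M p r ⟩
  (N + 2 * p) * (M + 2 * r) + 4 * suc r + N ∎
  where
  open ≤-Reasoning
  eq₁ : ∀ N M p r → (M + 2 * suc r) * N + 4 * suc r * (N + 2 * suc p) ≡ (M + 2 * r) * N + N + ((4 * suc r + 1) * N + 8 * suc r * suc p)
  eq₁ = solve-∀
  eq₂ : ∀ N M p r → (M + 2 * r) * N + N + (2 * p * M + 4 * p * r + 4 * suc r) ≡ (N + 2 * p) * (M + 2 * r) + 4 * suc r + N
  eq₂ = solve-∀

-- With N, M the powers of two in f(M(C_2s)), f(M(C_2l)): the 4l fibres waste at
-- most 4l (N + 2s - 1) pebbles, and M + 2l must be collected.
quota-loss : ∀ p r → 4 ≤ p → suc (suc p) ≤ r →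
  (2 ^ suc (suc r) + 2 * suc r) * 2 ^ suc (suc p) + 4 * suc r * (2 ^ suc (suc p) + 2 * suc p) <
  pebblingMC (suc p) * pebblingMC (suc r) + 4 * suc r + 2 ^ suc (suc p)
quota-loss p r 4≤p p+2≤r with m≤n⇒∃[o]m+o≡n 4≤p | m≤n⇒∃[o]m+o≡n p+2≤r
... | e , 4+e≡p | d , p+2+d≡r = quota-loss-NM (2 ^ suc (suc p)) (2 ^ suc (suc r)) p r
  (slack-pr 4+e≡p p+2+d≡r
    (subst (λ x → 64 + 32 * e ≤ 2 ^ suc (suc x)) 4+e≡p (64+32e≤2^[6+e] e))
    (subst (λ x → 4 * 2 ^ suc (suc p) * suc d ≤ 2 ^ suc (suc x)) p+2+d≡r (4N[1+d]≤2^[4+p+d] p d)))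

-- Collecting in the fibres of the product

sum-combine : ∀ {m n} (F : Fin (m * n) → ℕ) → sum F ≡ sum (λ i → sum (λ j → F (combine {m} {n} i j)))
sum-combine {zero}      F = refl
sum-combine {suc m} {n} F = trans (sum-↑ n F) (cong (sum (λ j → F (j ↑ˡ (m * n))) +_) (sum-combine {m} {n} (λ x → F (n ↑ʳ x))))

combine-homˡ : ∀ {G H} b → IsHom G (G □ H) (λ a → combine a b)
combine-homˡ {G} {H} b {a} {c} a~c = inj₂
  ( subst₂ (Adj G) (sym (cong proj₁ (decode a))) (sym (cong proj₁ (decode c))) a~c
  , trans (cong proj₂ (decode a)) (sym (cong proj₂ (decode c))) )
  where
  decode : ∀ a → remQuot (size H) (combine a b) ≡ (a , b)
  decode a = remQuot-combine a b

combine-homʳ : ∀ {G H} a → IsHom H (G □ H) (combine a)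
combine-homʳ {G} {H} a {b} {d} b~d = inj₁
  ( trans (cong proj₁ (decode b)) (sym (cong proj₁ (decode d)))
  , subst₂ (Adj H) (sym (cong proj₂ (decode b))) (sym (cong proj₂ (decode d))) b~d )
  where
  decode : ∀ b → remQuot (size H) (combine a b) ≡ (a , b)
  decode b = remQuot-combine a b

-- `pair` abstracts from the order of the factors, so that the smaller cycle always supplies the
-- fibres.
module _ (p r : ℕ) (4≤p : 4 ≤ p) (p+2≤r : suc (suc p) ≤ r) {X : Graph}
  (pair : Fin (size (MC (2 * suc p))) → Fin (size (MC (2 * suc r))) → Fin (size X))
  (homˡ : ∀ b → IsHom (MC (2 * suc p)) X (λ a → pair a b))
  (homʳ : ∀ a → IsHom (MC (2 * suc r)) X (pair a))
  (sum-pair : ∀ F → sum F ≡ sum (λ b → sum (λ a → F (pair a b))))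
  where

  private
    s = suc p
    l = suc r
    N = 2 ^ suc s
    M' = 2 ^ suc l

  product-⇝ : ∀ (D : Distribution X) g h → sum D ≡ pebblingMC s * pebblingMC l → X ⊢ D ⇝ 1 • pair g h
  product-⇝ D g h ΣD≡ = ⇝-trans gather (pushforward-⇝ (pair g) (homʳ g) t h 1 enough)
    where
    P t : Fin (size (MC (2 * l))) → ℕ
    P b = sum (λ a → D (pair a b))
    fibre-quota : ∀ b → ∃[ t ] (t ≡ 0 ⊎ t * N + 2 * s ≤ P b) × suc (P b) ≤ t * N + (N + 2 * s)
    fibre-quota b = quota N (2 * s) (P b) (m^n>0 2 (suc s))
    t b = proj₁ (fibre-quota b)

    fibre : ∀ b → X ⊢ pushforward (λ a → pair a b) (λ a → D (pair a b)) ⇝ t b • pair g b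
    fibre b with proj₁ (proj₂ (fibre-quota b))
    ... | inj₁ t≡0 = ⇝-≥ λ z → ≤-trans (≤-reflexive (cong (_* δ (pair g b) z) t≡0)) z≤n
    ... | inj₂ t≤  = pushforward-⇝ (λ a → pair a b) (homˡ b) (λ a → D (pair a b)) g (t b) t≤

    gather : X ⊢ D ⇝ pushforward (pair g) t
    gather = ⇝-resp-≤ (λ z → ≤-reflexive (split z)) (λ z → ≤-refl)
      (⇝-sum (λ b → pushforward (λ a → pair a b) (λ a → D (pair a b))) (λ b → t b • pair g b) fibre)
      where
      split : ∀ z → sum (λ b → pushforward (λ a → pair a b) (λ a → D (pair a b)) z) ≡ D z
      split z = begin
        sum (λ b → sum (λ a → D (pair a b) * δ (pair a b) z))  ≡⟨ sym (sum-pair (λ i → D i * δ i z)) ⟩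
        sum (λ i → D i * δ i z)                                ≡⟨ sum-cong-≗ (λ i → cong (D i *_) (δ-sym i z)) ⟩
        sum (λ i → D i * δ z i)                                ≡⟨ sum-δ D z ⟩
        D z                                                    ∎
        where open ≡-Reasoning

    loss : pebblingMC s * pebblingMC l + 4 * l ≤ sum t * N + 4 * l * (N + 2 * s)
    loss = begin
      pebblingMC s * pebblingMC l + 4 * l
        -- The summand `4 * l` provides a 1 for each fibre, matching the strict bound of `quota`.
        ≡⟨ cong₂ _+_ (trans (sym ΣD≡) (sum-pair D)) (trans (sym (size-MC l)) (trans (sym (*-identityʳ _)) (sym (sum-const (size (MC (2 * l))) 1)))) ⟩
      sum P + sum {size (MC (2 * l))} (λ _ → 1)        ≡⟨ sym (∑-distrib-+ P (λ _ → 1)) ⟩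
      sum (λ b → P b + 1)                              ≤⟨ sum-mono (λ b → ≤-trans (≤-reflexive (+-comm (P b) 1)) (proj₂ (proj₂ (fibre-quota b)))) ⟩
      sum (λ b → t b * N + (N + 2 * s))                ≡⟨ ∑-distrib-+ (λ b → t b * N) (λ _ → N + 2 * s) ⟩
      sum (λ b → t b * N) + sum {size (MC (2 * l))} (λ _ → N + 2 * s)
        ≡⟨ cong₂ _+_ (sym (*-distribʳ-sum N t)) (trans (sum-const (size (MC (2 * l))) _) (cong (_* (N + 2 * s)) (size-MC l))) ⟩
      sum t * N + 4 * l * (N + 2 * s)                  ∎
      where open ≤-Reasoning

    enough : 1 * M' + 2 * l ≤ sum t
    enough with M' + 2 * l ≤? sum t
    ... | yes le = subst (λ x → x + 2 * l ≤ sum t) (sym (*-identityˡ M')) le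
    -- The extra `N` in `quota-loss` turns `sum t` into `suc (sum t)`, which is at most `M' + 2 * l`
    -- if too little was collected.
    ... | no ¬le = contradiction (quota-loss p r 4≤p p+2≤r) (≤⇒≯ (begin
      pebblingMC s * pebblingMC l + 4 * l + N             ≤⟨ +-monoˡ-≤ N loss ⟩
      sum t * N + 4 * l * (N + 2 * s) + N                 ≡⟨ eq (sum t) N (4 * l * (N + 2 * s)) ⟩
      suc (sum t) * N + 4 * l * (N + 2 * s)               ≤⟨ +-monoˡ-≤ (4 * l * (N + 2 * s)) (*-monoˡ-≤ N (≰⇒> ¬le)) ⟩
      (M' + 2 * l) * N + 4 * l * (N + 2 * s)              ∎))
      where
      open ≤-Reasoning
      eq : ∀ x N y → x * N + y + N ≡ suc x * N + y
      eq = solve-∀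

≤-sum : ∀ {n} (F : Fin n → ℕ) i → F i ≤ sum F
≤-sum F Fin.zero    = m≤m+n _ _
≤-sum F (Fin.suc i) = ≤-trans (≤-sum (F ∘ Fin.suc) i) (m≤n+m _ (F Fin.zero))

-- Lower bound for the middle graph of a cycle

-- Solvability speaks of exactly `K` pebbles, so the bad distribution has to be thinned out to
-- refute every smaller count as well.
sub-distribution : ∀ {n} (F : Fin n → ℕ) K → K ≤ sum F → ∃[ D ] (∀ i → D i ≤ F i) × sum {n} D ≡ K
sub-distribution {zero}  F zero z≤n = (λ ()) , (λ ()) , refl
sub-distribution {suc n} F K K≤ with sub-distribution (F ∘ Fin.suc) (K ∸ F Fin.zero) (m≤n+o⇒m∸n≤o K (F Fin.zero) K≤)
... | D , D≤F , ΣD = D₀ , D₀≤F , trans (cong (F Fin.zero ⊓ K +_) ΣD) (m⊓n+n∸m≡n (F Fin.zero) K)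
  where
  D₀ : Fin (suc n) → ℕ
  D₀ Fin.zero    = F Fin.zero ⊓ K
  D₀ (Fin.suc i) = D i
  D₀≤F : ∀ i → D₀ i ≤ F i
  D₀≤F Fin.zero    = m⊓n≤m (F Fin.zero) K
  D₀≤F (Fin.suc i) = D≤F i

1+m∸n≤1+[m∸n] : ∀ m n → suc m ∸ n ≤ suc (m ∸ n)
1+m∸n≤1+[m∸n] m n = m≤n+o⇒m∸n≤o (suc m) n (≤-trans (s≤s (m≤n+m∸n m n)) (≤-reflexive (sym (+-suc n (m ∸ n)))))

m∸n≤1+[m∸1+n] : ∀ m n → m ∸ n ≤ suc (m ∸ suc n)
m∸n≤1+[m∸1+n] m n = m≤n+o⇒m∸n≤o m n (≤-trans (m≤n+m∸n m (suc n)) (≤-reflexive (sym (+-suc n (m ∸ suc n)))))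

proj₂-lookup-cycleEdges : ∀ k e → proj₂ (List.lookup (cycleEdges k) e) ≡ cycNext (proj₁ (List.lookup (cycleEdges k) e))
proj₂-lookup-cycleEdges k = go (List.allFin k)
  where
  go : ∀ xs (e : Fin (List.length (List.map (λ i → i , cycNext i) xs))) →
    proj₂ (List.lookup (List.map (λ i → i , cycNext i) xs) e) ≡ cycNext (proj₁ (List.lookup (List.map (λ i → i , cycNext i) xs) e))
  go (x List.∷ xs) Fin.zero    = refl
  go (x List.∷ xs) (Fin.suc e) = go xs e

⇝⇒Solvable : ∀ {X} v j → (∀ D → sum D ≡ j → X ⊢ D ⇝ 1 • v) → Solvable X v j
⇝⇒Solvable {X} v j r D ΣD with r D (trans (sym (total≡sum X D)) ΣD)
... | D' , D↝D' , le = D' , D↝D' , subst (_≤ D' v) (trans (*-identityˡ _) (δ-refl v)) (le v)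
  where
  δ-refl : ∀ {m} (u : Fin m) → δ u u ≡ 1
  δ-refl Fin.zero    = refl
  δ-refl (Fin.suc u) = δ-refl u

module _ (n' : ℕ) where

  private
    n = suc n'
    K = 2 * n
    Es = cycleEdges K
    V = Fin K ⊎ Fin (List.length Es)
    N = 2 ^ suc n

    tail-of : Fin (List.length Es) → Fin K
    tail-of e = proj₁ (List.lookup Es e)

    atOrigin : Fin K → ℕ
    atOrigin Fin.zero    = 1
    atOrigin (Fin.suc _) = 0

    -- Both are n + 1 minus the distance to the origin, except xU 0 = n.
    xE xU : ℕ → ℕ
    xE i = (n ∸ i) + (suc i ∸ n)
    xU i = (n ∸ i) + (i ∸ n)

    -- A new vertex and its endpoint are adjacent, so their distances to the origin differ by at
    -- most one. The two bounds serve the two directions of a move.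
    endpoint-exponents : ∀ {u e} → Endpoint u (List.lookup Es e) → xU (toℕ u) ≤ xE (toℕ (tail-of e)) × xE (toℕ (tail-of e)) ≤ suc (xU (toℕ u))
    endpoint-exponents {e = e} (inj₁ refl) =
      +-monoʳ-≤ (n ∸ i) (∸-monoˡ-≤ n (n≤1+n i)) ,
      ≤-trans (+-monoʳ-≤ (n ∸ i) (1+m∸n≤1+[m∸n] i n)) (≤-reflexive (+-suc _ _))
      where i = toℕ (tail-of e)
    endpoint-exponents {u} {e} (inj₂ u≡) = subst (λ x → xU x ≤ xE i × xE i ≤ suc (xU x)) (sym (cong toℕ (trans u≡ (proj₂-lookup-cycleEdges K e)))) next
      where
      i = toℕ (tail-of e)
      next : xU (toℕ (cycNext (tail-of e))) ≤ xE i × xE i ≤ suc (xU (toℕ (cycNext (tail-of e))))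
      next with m≤n⇒m<n∨m≡n (toℕ≤pred[n] (tail-of e))
      ... | inj₁ i<k = subst (λ x → xU x ≤ xE i × xE i ≤ suc (xU x)) (sym (toℕ-cycNext (tail-of e) (s≤s i<k)))
              ( +-monoˡ-≤ (suc i ∸ n) (∸-monoʳ-≤ n (n≤1+n i))
              , +-monoˡ-≤ (suc i ∸ n) (m∸n≤1+[m∸1+n] n i))
      -- The closing edge of the cycle leads back to the origin; both exponents are `n`, because of
      -- the exceptional value of `xU 0`.
      ... | inj₂ i≡k = subst (λ x → xU x ≤ xE i × xE i ≤ suc (xU x)) (sym (cong toℕ (cycNext-last (tail-of e) i≡k)))
              ( ≤-reflexive (trans xU0 (sym xElast))
              , ≤-trans (≤-reflexive (trans xElast (sym xU0))) (n≤1+n _))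
        where
        xU0 : xU 0 ≡ n
        xU0 = +-identityʳ n
        xElast : xE i ≡ n
        xElast = cong₂ _+_ {n ∸ i} {0}
          (m≤n⇒m∸n≡0 (≤-trans (≤-trans (≤-reflexive (sym (+-identityʳ n))) (m≤n+m (n + 0) n')) (≤-reflexive (sym i≡k))))
          (trans (cong (λ x → suc x ∸ n) i≡k) (trans (m+n∸m≡n n (n + 0)) (+-identityʳ n)))

    -- gain: upper bound for the growth of the potential when a pebble is put on a
    -- vertex; cost: its drop when two are taken away.
    gain cost : V → ℕ
    gain (inj₁ u) = 2 * 2 ^ xU (toℕ u)
    gain (inj₂ e) = 2 ^ xE (toℕ (tail-of e))
    cost (inj₁ u) = 2 * 2 ^ xU (toℕ u)
    cost (inj₂ e) = 2 * 2 ^ xE (toℕ (tail-of e))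

    -- Two new vertices are compared through the original vertex their edges share.
    gain≤cost : ∀ x y → MAdj Es x y → gain y ≤ cost x
    gain≤cost (inj₁ u) (inj₂ e) p = ^-monoʳ-≤ 2 (proj₂ (endpoint-exponents {u} {e} p))
    gain≤cost (inj₂ e) (inj₁ u) p = *-monoʳ-≤ 2 (^-monoʳ-≤ 2 (proj₁ (endpoint-exponents {u} {e} p)))
    gain≤cost (inj₂ e) (inj₂ e') (_ , inj₁ p) = ^-monoʳ-≤ 2 (≤-trans (proj₂ (endpoint-exponents {_} {e'} p)) (s≤s (proj₁ (endpoint-exponents {_} {e} (inj₁ refl)))))
    gain≤cost (inj₂ e) (inj₂ e') (_ , inj₂ p) = ^-monoʳ-≤ 2 (≤-trans (proj₂ (endpoint-exponents {_} {e'} p)) (s≤s (proj₁ (endpoint-exponents {_} {e} (inj₂ refl)))))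

    -- An unpaired pebble on an original vertex is useless, except on the target,
    -- where atOrigin completes the pair.
    φ : V → ℕ → ℕ
    φ (inj₁ u) d = 2 * 2 ^ xU (toℕ u) * ⌊ d + atOrigin u /2⌋
    φ (inj₂ e) d = 2 ^ xE (toℕ (tail-of e)) * d

    φ-cost : ∀ x {d} → 2 ≤ d → φ x (d ∸ 2) + cost x ≡ φ x d
    φ-cost (inj₁ u) {suc (suc d)} _ = trans (+-comm _ (cost (inj₁ u))) (sym (*-suc (cost (inj₁ u)) _))
    φ-cost (inj₂ e) {suc (suc d)} _ = eq (2 ^ xE (toℕ (tail-of e))) d
      where
      eq : ∀ w d → w * d + 2 * w ≡ w * suc (suc d)
      eq = solve-∀
    φ-cost _ {suc zero} (s≤s ())

    φ-gain : ∀ x d → φ x (d + 1) ≤ φ x d + gain x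
    φ-gain (inj₁ u) d = begin
      c * ⌊ d + 1 + atOrigin u /2⌋        ≡⟨ cong (λ y → c * ⌊ y + atOrigin u /2⌋) (+-comm d 1) ⟩
      c * ⌊ suc (d + atOrigin u) /2⌋      ≤⟨ *-monoʳ-≤ c (⌊n/2⌋-mono (n≤1+n _)) ⟩
      c * suc ⌊ d + atOrigin u /2⌋        ≡⟨ *-suc c _ ⟩
      c + c * ⌊ d + atOrigin u /2⌋        ≡⟨ +-comm c _ ⟩
      c * ⌊ d + atOrigin u /2⌋ + c        ∎
      where
      open ≤-Reasoning
      c = cost (inj₁ u)
    φ-gain (inj₂ e) d = ≤-reflexive (eq (2 ^ xE (toℕ (tail-of e))) d)
      where
      eq : ∀ w d → w * (d + 1) ≡ w * d + w
      eq = solve-∀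

    φ-mono : ∀ x {d d'} → d ≤ d' → φ x d ≤ φ x d'
    φ-mono (inj₁ u) le = *-monoʳ-≤ (2 * 2 ^ xU (toℕ u)) (⌊n/2⌋-mono (+-monoˡ-≤ (atOrigin u) le))
    φ-mono (inj₂ e) le = *-monoʳ-≤ (2 ^ xE (toℕ (tail-of e))) le

    vertex : Fin (size (MC K)) → V
    vertex = splitAt K

    potential : Distribution (MC K) → ℕ
    potential D = sum λ x → φ (vertex x) (D x)

    -- The cost at `u` is added on both sides, so that the removal of a pair becomes an equation
    -- without subtraction.
    potential-move : ∀ D {u w} → Adj (MC K) u w → 2 ≤ D u → potential (move (MC K) u w D) ≤ potential D
    potential-move D {u} {w} u~w 2≤Du = +-cancelʳ-≤ (cost (vertex u)) _ _ (begin
      potential D' + cost (vertex u)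
        ≡⟨ cong (potential D' +_) (sym (sum-δ (cost ∘ vertex) u)) ⟩
      potential D' + sum (λ x → cost (vertex x) * δ u x)
        ≡⟨ sym (∑-distrib-+ (λ x → φ (vertex x) (D' x)) (λ x → cost (vertex x) * δ u x)) ⟩
      sum (λ x → φ (vertex x) (D' x) + cost (vertex x) * δ u x)
        ≤⟨ sum-mono pointwise ⟩
      sum (λ x → φ (vertex x) (D x) + gain (vertex x) * δ w x)
        ≡⟨ ∑-distrib-+ (λ x → φ (vertex x) (D x)) (λ x → gain (vertex x) * δ w x) ⟩
      potential D + sum (λ x → gain (vertex x) * δ w x)
        ≡⟨ cong (potential D +_) (sum-δ (gain ∘ vertex) w) ⟩
      potential D + gain (vertex w)
        ≤⟨ +-monoʳ-≤ (potential D) (gain≤cost (vertex u) (vertex w) u~w) ⟩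
      potential D + cost (vertex u) ∎)
      where
      open ≤-Reasoning
      D' = move (MC K) u w D
      removed : Fin (size (MC K)) → ℕ
      removed x = if does (x ≟ u) then 2 else 0
      remove : ∀ x → φ (vertex x) (D x ∸ removed x) + cost (vertex x) * δ u x ≡ φ (vertex x) (D x)
      remove x with x ≟ u
      ... | yes refl = trans (cong (φ (vertex x) (D x ∸ 2) +_) (*-identityʳ _)) (φ-cost (vertex x) 2≤Du)
      ... | no _     = trans (cong (φ (vertex x) (D x) +_) (*-zeroʳ (cost (vertex x)))) (+-identityʳ _)
      add : ∀ x d → φ (vertex x) (d + δ w x) ≤ φ (vertex x) d + gain (vertex x) * δ w x
      add x d with x ≟ w
      ... | yes _ = ≤-trans (φ-gain (vertex x) d) (≤-reflexive (cong (φ (vertex x) d +_) (sym (*-identityʳ _))))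
      ... | no _  = ≤-trans (≤-reflexive (cong (φ (vertex x)) (+-identityʳ d))) (m≤m+n _ _)
      pointwise : ∀ x → φ (vertex x) (D' x) + cost (vertex x) * δ u x ≤ φ (vertex x) (D x) + gain (vertex x) * δ w x
      pointwise x = begin
        φ (vertex x) (D' x) + cost (vertex x) * δ u x
          ≤⟨ +-monoˡ-≤ (cost (vertex x) * δ u x) (add x (D x ∸ removed x)) ⟩
        φ (vertex x) (D x ∸ removed x) + gain (vertex x) * δ w x + cost (vertex x) * δ u x
          ≡⟨ eq (φ (vertex x) (D x ∸ removed x)) (gain (vertex x) * δ w x) (cost (vertex x) * δ u x) ⟩
        φ (vertex x) (D x ∸ removed x) + cost (vertex x) * δ u x + gain (vertex x) * δ w x
          ≡⟨ cong (_+ gain (vertex x) * δ w x) (remove x) ⟩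
        φ (vertex x) (D x) + gain (vertex x) * δ w x ∎
        where
        eq : ∀ a b c → a + b + c ≡ a + c + b
        eq = solve-∀

    potential-reach : ∀ {D D'} → Reach (MC K) D D' → potential D' ≤ potential D
    potential-reach ε = ≤-refl
    potential-reach (step {D} u w u~w 2≤Du ◅ r) = ≤-trans (potential-reach r) (potential-move D {u} {w} u~w 2≤Du)

    origin antipode : Fin K
    origin   = Fin.zero
    antipode = cyc n

    toℕ-antipode : toℕ antipode ≡ n
    toℕ-antipode = toℕ-cyc {j = n} (s≤s (≤-trans (≤-reflexive (sym (+-identityʳ n))) (m≤n+m (n + 0) n')))

    N≤potential : ∀ D → 1 ≤ D (U origin) → N ≤ potential D
    N≤potential D 1≤D = begin
      2 * 2 ^ n                                  ≡⟨ cong (λ x → 2 * 2 ^ x) (sym (+-identityʳ n)) ⟩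
      2 * 2 ^ xU 0                               ≡⟨ sym (*-identityʳ _) ⟩
      2 * 2 ^ xU 0 * 1                           ≤⟨ *-monoʳ-≤ (2 * 2 ^ xU 0) (⌊n/2⌋-mono (+-monoˡ-≤ 1 1≤D)) ⟩
      φ (inj₁ origin) (D (U origin))             ≡⟨ cong (λ x → φ x (D (U origin))) (sym (splitAt-↑ˡ K origin _)) ⟩
      φ (vertex (U origin)) (D (U origin))       ≤⟨ ≤-sum (λ x → φ (vertex x) (D x)) (U origin) ⟩
      potential D                                ∎
      where open ≤-Reasoning

    bad : V → ℕ
    bad (inj₁ u) = (1 ∸ atOrigin u) + (N ∸ 2) * δ antipode u
    bad (inj₂ e) = 0

    2≤N : 2 ≤ N
    2≤N = *-monoʳ-≤ 2 (m^n>0 2 n)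

    1∸atOrigin+atOrigin : ∀ u → 1 ∸ atOrigin u + atOrigin u ≡ 1
    1∸atOrigin+atOrigin Fin.zero    = refl
    1∸atOrigin+atOrigin (Fin.suc u) = refl

    sum-atOrigin : sum atOrigin ≡ 1
    sum-atOrigin = cong suc (trans (sum-const (n' + (n + 0)) 0) (*-zeroʳ (n' + (n + 0))))

    sum-bad : suc (sum (bad ∘ vertex)) ≡ pebblingMC n
    sum-bad = begin
      suc (sum (bad ∘ vertex))
        ≡⟨ cong suc (sum-MC {K} (bad ∘ vertex)) ⟩
      suc (sum (λ u → bad (vertex (U {K} u))) + sum (λ i → bad (vertex (E {K} i))))
        ≡⟨ cong suc (cong₂ _+_ (sum-cong-≗ {K} λ u → cong bad (splitAt-↑ˡ K u _))
             (trans (sum-cong-≗ {K} λ i → cong bad (splitAt-↑ʳ K _ (edge i))) (trans (sum-const K 0) (*-zeroʳ K)))) ⟩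
      suc (sum (λ u → bad (inj₁ u)) + 0)
        ≡⟨ cong suc (+-identityʳ _) ⟩
      suc (sum (λ u → bad (inj₁ u)))
        -- The successor becomes the pebble missing on the target, so that every original vertex
        -- carries one.
        ≡⟨ trans (+-comm 1 _) (cong (sum (λ u → bad (inj₁ u)) +_) (sym sum-atOrigin)) ⟩
      sum (λ u → bad (inj₁ u)) + sum atOrigin
        ≡⟨ sym (∑-distrib-+ (λ u → bad (inj₁ u)) atOrigin) ⟩
      sum (λ u → bad (inj₁ u) + atOrigin u)
        ≡⟨ sum-cong-≗ {K} (λ u → trans (eq (1 ∸ atOrigin u) ((N ∸ 2) * δ antipode u) (atOrigin u)) (cong (_+ (N ∸ 2) * δ antipode u) (1∸atOrigin+atOrigin u))) ⟩
      sum (λ u → 1 + (N ∸ 2) * δ antipode u)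
        ≡⟨ ∑-distrib-+ {K} (λ _ → 1) (λ u → (N ∸ 2) * δ antipode u) ⟩
      sum {K} (λ _ → 1) + sum (λ u → (N ∸ 2) * δ antipode u)
        ≡⟨ cong₂ _+_ (trans (sum-const K 1) (*-identityʳ K)) (sum-δ (λ _ → N ∸ 2) antipode) ⟩
      2 * suc n' + (N ∸ 2)            ≡⟨ eq₂ n' (N ∸ 2) ⟩
      N ∸ 2 + 2 + 2 * n'              ≡⟨ cong (_+ 2 * n') (m∸n+n≡m 2≤N) ⟩
      N + 2 * n'                      ∎
      where
      open ≡-Reasoning
      eq : ∀ a b c → a + b + c ≡ a + c + b
      eq = solve-∀
      eq₂ : ∀ n x → 2 * suc n + x ≡ x + 2 + 2 * n
      eq₂ = solve-∀

    -- Away from the antipode there is no pair to count. At the antipode the exponent is 0, so the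
    -- potential is at most the `N - 1` pebbles there.
    φ-bad : ∀ u → φ (inj₁ u) (bad (inj₁ u)) ≤ pred N * δ antipode u
    φ-bad u with u ≟ antipode
    ... | yes refl = begin
      2 * 2 ^ xU (toℕ antipode) * ⌊ 1 ∸ atOrigin u + (N ∸ 2) * 1 + atOrigin u /2⌋
        ≡⟨ cong₂ (λ x y → 2 * 2 ^ x * ⌊ y /2⌋) (trans (cong xU toℕ-antipode) (cong₂ _+_ (n∸n≡0 n) (n∸n≡0 n)))
             (trans (eq (1 ∸ atOrigin u) ((N ∸ 2) * 1) (atOrigin u)) (cong₂ _+_ {v = N ∸ 2} (1∸atOrigin+atOrigin u) (*-identityʳ (N ∸ 2)))) ⟩
      2 * ⌊ 1 + (N ∸ 2) /2⌋          ≤⟨ 2⌊n/2⌋≤n (1 + (N ∸ 2)) ⟩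
      1 + (N ∸ 2)                    ≡⟨ suc-∸2 2≤N ⟩
      pred N                         ≡⟨ sym (*-identityʳ (pred N)) ⟩
      pred N * 1                     ∎
      where
      open ≤-Reasoning
      eq : ∀ a b c → a + b + c ≡ a + c + b
      eq = solve-∀
      suc-∸2 : ∀ {x} → 2 ≤ x → suc (x ∸ 2) ≡ pred x
      suc-∸2 (s≤s (s≤s _)) = refl
    ... | no _ = begin
      2 * 2 ^ xU (toℕ u) * ⌊ 1 ∸ atOrigin u + (N ∸ 2) * 0 + atOrigin u /2⌋
        ≡⟨ cong (λ x → 2 * 2 ^ xU (toℕ u) * ⌊ x /2⌋)
             (trans (cong (λ x → 1 ∸ atOrigin u + x + atOrigin u) (*-zeroʳ (N ∸ 2))) (trans (cong (_+ atOrigin u) (+-identityʳ _)) (1∸atOrigin+atOrigin u))) ⟩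
      2 * 2 ^ xU (toℕ u) * 0         ≡⟨ *-zeroʳ (2 * 2 ^ xU (toℕ u)) ⟩
      0                              ≤⟨ z≤n ⟩
      pred N * 0                     ∎
      where open ≤-Reasoning

    potential-bad : potential (bad ∘ vertex) < N
    potential-bad = begin-strict
      potential (bad ∘ vertex)
        ≡⟨ sum-MC {K} (λ x → φ (vertex x) (bad (vertex x))) ⟩
      sum (λ u → φ (vertex (U {K} u)) (bad (vertex (U {K} u)))) + sum (λ i → φ (vertex (E {K} i)) (bad (vertex (E {K} i))))
        ≡⟨ cong₂ _+_ (sum-cong-≗ {K} λ u → cong (λ x → φ x (bad x)) (splitAt-↑ˡ K u _))
             (trans (sum-cong-≗ {K} λ i → trans (cong (λ x → φ x (bad x)) (splitAt-↑ʳ K _ (edge i))) (*-zeroʳ (2 ^ xE (toℕ (tail-of (edge i))))))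
                    (trans (sum-const K 0) (*-zeroʳ K))) ⟩
      sum (λ u → φ (inj₁ u) (bad (inj₁ u))) + 0   ≡⟨ +-identityʳ _ ⟩
      sum (λ u → φ (inj₁ u) (bad (inj₁ u)))       ≤⟨ sum-mono φ-bad ⟩
      sum (λ u → pred N * δ antipode u)           ≡⟨ sum-δ (λ _ → pred N) antipode ⟩
      pred N                                      <⟨ pred< 2≤N ⟩
      N                                           ∎
      where
      open ≤-Reasoning
      pred< : ∀ {x} → 2 ≤ x → pred x < x
      pred< (s≤s _) = ≤-refl

  -- A pebble on the target forces potential at least `N`, moves never raise the potential, and
  -- parts of the bad distribution start below `N`.
  Solvable-lower-bound : ∀ j → Solvable (MC K) (U origin) j → pebblingMC n ≤ j
  Solvable-lower-bound j solve = ≮⇒≥ λ j<A →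
    let D , D≤bad , ΣD = sub-distribution (bad ∘ vertex) j (s≤s⁻¹ (subst (suc j ≤_) (sym sum-bad) j<A))
        D' , r , 1≤D'  = solve D (trans (total≡sum (MC K) D) ΣD)
    in <⇒≱ potential-bad (begin
      N                        ≤⟨ N≤potential D' 1≤D' ⟩
      potential D'             ≤⟨ potential-reach r ⟩
      potential D              ≤⟨ sum-mono (λ x → φ-mono (vertex x) (D≤bad x)) ⟩
      potential (bad ∘ vertex) ∎)
    where open ≤-Reasoning

  MC-solvable : ∀ r → Solvable (MC K) r (1 * N + 2 * n)
  MC-solvable r = ⇝⇒Solvable r _ λ D ΣD → ⇝-resp-≤ (λ z → ≤-reflexive (same D z)) (λ z → ≤-refl)
    (pushforward-⇝ {n'} id id D r 1 (≤-reflexive (sym ΣD)))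
    where
    same : ∀ D z → pushforward id D z ≡ D z
    same D z = trans (sum-cong-≗ λ i → cong (D i *_) (δ-sym i z)) (sum-δ D z)

  -- Maximality of `a` speaks only of vertices that have a pebbling number, so one must exist at the
  -- origin. Solvability is not decided, so this existence is obtained under a double negation,
  -- which the decidability of `≤` removes.
  pebblingMC-≤ : ∀ a → IsPebblingNumber (MC K) a → pebblingMC n ≤ a
  pebblingMC-≤ a (_ , maximal) = decidable-stable (pebblingMC n ≤? a) λ ¬le →
    unsolvable (λ j isNumber → ¬le (≤-trans (Solvable-lower-bound j (proj₁ isNumber)) (maximal (U origin) j isNumber)))
      _ (MC-solvable (U origin))
    where
    unsolvable : (∀ j → ¬ IsPebblingNumberAt (MC K) (U origin) j) → ∀ j → ¬ Solvable (MC K) (U origin) j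
    -- Least-number principle: a solvable `j` with no smaller solvable count would be a pebbling
    -- number.
    unsolvable none = <-rec (λ j → ¬ Solvable (MC K) (U origin) j) λ j smaller solvable →
      none j (solvable , λ i solvableᵢ → ≮⇒≥ λ i<j → smaller i<j solvableᵢ)

-- The bound for the product

product-solvable : ∀ m n → 5 ≤ m → 5 ≤ n → (m + 2 ≤ n ⊎ n + 2 ≤ m) → ∀ v →
  Solvable (MC (2 * n) □ MC (2 * m)) v (pebblingMC n * pebblingMC m)
product-solvable (suc p) (suc r) (s≤s 4≤p) _ (inj₁ (s≤s p+2≤r)) v = ⇝⇒Solvable v _ λ D ΣD →
  subst (λ v → X ⊢ D ⇝ 1 • v) (combine-remQuot {size G} (size H) v)
    -- The larger cycle is the first factor here, so the coordinates are swapped.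
    (product-⇝ p r 4≤p (subst (_≤ r) (+-comm p 2) p+2≤r) (λ a b → combine b a) (λ b {u} {w} → combine-homʳ {G} {H} b {u} {w}) (λ a {u} {w} → combine-homˡ {G} {H} a {u} {w})
      (sum-combine {size G} {size H}) D (proj₂ (remQuot {size G} (size H) v)) (proj₁ (remQuot {size G} (size H) v))
      (trans ΣD (*-comm (pebblingMC (suc r)) (pebblingMC (suc p)))))
  where
  G = MC (2 * suc r)
  H = MC (2 * suc p)
  X = G □ H
product-solvable (suc r) (suc p) _ (s≤s 4≤p) (inj₂ (s≤s p+2≤r)) v = ⇝⇒Solvable v _ λ D ΣD →
  subst (λ v → X ⊢ D ⇝ 1 • v) (combine-remQuot {size G} (size H) v)
    (product-⇝ p r 4≤p (subst (_≤ r) (+-comm p 2) p+2≤r) combine (λ b {u} {w} → combine-homˡ {G} {H} b {u} {w}) (λ a {u} {w} → combine-homʳ {G} {H} a {u} {w})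
      (λ F → trans (sum-combine {size G} {size H} F) (∑-comm {size G} {size H} (λ a b → F (combine a b))))
      D (proj₁ (remQuot {size G} (size H) v)) (proj₂ (remQuot {size G} (size H) v)) ΣD)
  where
  G = MC (2 * suc p)
  H = MC (2 * suc r)
  X = G □ H

theorem2p8 : (m n : ℕ) → 5 ≤ m → 5 ≤ n → (m + 2 ≤ n ⊎ n + 2 ≤ m) →
    (a b c : ℕ) → IsPebblingNumber (MC (2 * n)) a → IsPebblingNumber (MC (2 * m)) b →
    IsPebblingNumber (MC (2 * n) □ MC (2 * m)) c → c ≤ a * b
theorem2p8 (suc m') (suc n') 5≤m 5≤n gap a b c isA isB ((v , _ , minimal) , _) =
  -- Since `c` is least at the vertex `v` attaining it, any count solvable at `v` bounds it from
  -- above.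
  ≤-trans (minimal _ (product-solvable (suc m') (suc n') 5≤m 5≤n gap v))
          (*-mono-≤ (pebblingMC-≤ n' a isA) (pebblingMC-≤ m' b isB))
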